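{- Let $k\ge1$, let $t_1,\dots,t_k$ be integers such that $\mathcal{C}(X)=X^k-t_1X^{k-1}-\dots-t_k$ is irreducible over $\mathbb{Q}$, and let $p$ be a prime with $p\nmid t_k$. Then $p$ divides $c_p[t_1,\dots,t_k]$ if and only if $p$ divides the discriminant $\operatorname{disc}(\mathcal{C})$ of the polynomial $\mathcal{C}$.
   Context: $c_p[t_1,\dots,t_k]$ is the least period of the sequence $(F_{k,n}(t_1,\dots,t_k)\bmod p)_{n\ge0}$, where $F_{k,0}=1$, $F_{k,m}=0$ for $-k+1\le m\le-1$, and $F_{k,n}=\sum_{j=1}^kt_jF_{k,n-j}$ for $n\ge1$ (equivalently $F_{k,n}=\sum_{\alpha}\binom{|\alpha|}{\alpha_1,\dots,\alpha_k}t_1^{\alpha_1}\cdots t_k^{\alpha_k}$ over $\alpha\in\mathbb{Z}_{\ge0}^k$ with $\sum_jj\alpha_j=n$, $|\alpha|=\sum_j\alpha_j$). The discriminant of $\mathcal{C}$ is $\operatorname{disc}(\mathcal{C})=(-1)^{k(k-1)/2}\prod_{i}\mathcal{C}'(\lambda_i)$ over the roots $\lambda_i$ of $\mathcal{C}$. -}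

module Defs where

open import Data.Nat as ℕ using (ℕ; zero; suc; _<_; _≤_; _≤?_; _∸_)
open import Data.Nat.Properties using (<-cmp)
open import Data.Nat.DivMod using (_/_)
open import Data.Nat.Primality using (Prime)
open import Data.Fin as Fin using (Fin; toℕ; fromℕ<; opposite; punchIn)
open import Data.Integer as ℤ using (ℤ; +_; -_)
open import Data.Integer.Divisibility using () renaming (_∣_ to _∣ℤ_)
open import Data.Rational as ℚ using (ℚ)
open import Data.List using (List; []; _∷_)
open import Data.Product using (Σ; _×_; ∃)
open import Data.Bool using (if_then_else_)
open import Relation.Binary using (tri<; tri≈; tri>)
open import Relation.Binary.PropositionalEquality using (_≡_)
open import Relation.Nullary using (¬_; does)

sumFin : ∀ {n} → (Fin n → ℤ) → ℤ
sumFin {zero}  f = + 0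
sumFin {suc n} f = f Fin.zero ℤ.+ sumFin (λ i → f (Fin.suc i))

sumUpToℚ : ℕ → (ℕ → ℚ) → ℚ
sumUpToℚ zero    f = f 0
sumUpToℚ (suc n) f = sumUpToℚ n f ℚ.+ f (suc n)

-- The sequence F_{k,n}(t_1,…,t_k); t_j is  t (j-1)  for t : Fin k → ℤ.

-- list lookup with default 0 (encodes F_{k,m} = 0 for m < 0)
nth0 : List ℤ → ℕ → ℤ
nth0 []       _       = + 0
nth0 (x ∷ xs) zero    = x
nth0 (x ∷ xs) (suc i) = nth0 xs i

-- history n = [F n , F (n-1) , … , F 0]
history : (k : ℕ) → (Fin k → ℤ) → ℕ → List ℤ
history k t zero    = + 1 ∷ []
history k t (suc n) =
  sumFin (λ (j : Fin k) → t j ℤ.* nth0 (history k t n) (toℕ j)) ∷ history k t n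

F : (k : ℕ) → (Fin k → ℤ) → ℕ → ℤ
F k t n = nth0 (history k t n) 0

_≡_[mod_] : ℤ → ℤ → ℕ → Set
a ≡ b [mod p ] = (+ p) ∣ℤ (a ℤ.- b)

IsPeriodMod : ℕ → (ℕ → ℤ) → ℕ → Set
IsPeriodMod p u T = 1 ≤ T × (∀ n → u (n ℕ.+ T) ≡ u n [mod p ])

IsLeastPeriodMod : ℕ → (ℕ → ℤ) → ℕ → Set
IsLeastPeriodMod p u T =
  IsPeriodMod p u T × (∀ T' → IsPeriodMod p u T' → T ≤ T')

-- The characteristic polynomial C(X) = X^k - t_1 X^{k-1} - … - t_k,
-- given by its coefficient function (coefficient of X^i).

coeffC : (k : ℕ) → (Fin k → ℤ) → ℕ → ℤ
coeffC k t i with <-cmp i k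
... | tri< i<k _ _ = - t (opposite (fromℕ< i<k))   -- coefficient of X^i is -t_{k-i}
... | tri≈ _ _ _   = + 1
... | tri> _ _ _   = + 0

coeffC' : (k : ℕ) → (Fin k → ℤ) → ℕ → ℤ
coeffC' k t i = (+ suc i) ℤ.* coeffC k t (suc i)

toℚ : ℤ → ℚ
toℚ z = z ℚ./ 1

convℚ : (ℕ → ℚ) → (ℕ → ℚ) → ℕ → ℚ
convℚ f g n = sumUpToℚ n (λ i → f i ℚ.* g (n ∸ i))

ReducibleOverℚ : (ℕ → ℚ) → Set
ReducibleOverℚ h =
  Σ ℕ λ a → Σ ℕ λ b → Σ (ℕ → ℚ) λ f → Σ (ℕ → ℚ) λ g →
    1 ≤ a × 1 ≤ b
    × (∀ i → a < i → f i ≡ ℚ.0ℚ) × ¬ (f a ≡ ℚ.0ℚ)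
    × (∀ j → b < j → g j ≡ ℚ.0ℚ) × ¬ (g b ≡ ℚ.0ℚ)
    × (∀ n → convℚ f g n ≡ h n)

IrreducibleOverℚ : (d : ℕ) → (ℕ → ℚ) → Set
IrreducibleOverℚ d h = 1 ≤ d × ¬ ReducibleOverℚ h

signPow : ℕ → ℤ
signPow zero    = + 1
signPow (suc n) = - signPow n

det : (n : ℕ) → (Fin n → Fin n → ℤ) → ℤ
det zero    M = + 1
det (suc n) M =
  sumFin (λ (j : Fin (suc n)) →
    signPow (toℕ j) ℤ.* (M Fin.zero j ℤ.* det n (λ r c → M (Fin.suc r) (punchIn j c))))

-- entry of the band row starting at column r, for a polynomial of degree d
band : (d : ℕ) → (ℕ → ℤ) → ℕ → ℕ → ℤ
band d a r c =
  if does (r ≤? c) then (if does (c ∸ r ≤? d) then a (d ∸ (c ∸ r)) else + 0) else + 0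

sylvester : (m : ℕ) → (ℕ → ℤ) → (n : ℕ) → (ℕ → ℤ) → Fin (n ℕ.+ m) → Fin (n ℕ.+ m) → ℤ
sylvester m a n b r c =
  if does (suc (toℕ r) ≤? n)
  then band m a (toℕ r) (toℕ c)
  else band n b (toℕ r ∸ n) (toℕ c)

resultant : (m : ℕ) → (ℕ → ℤ) → (n : ℕ) → (ℕ → ℤ) → ℤ
resultant m a n b = det (n ℕ.+ m) (sylvester m a n b)

-- disc(C) = (-1)^{k(k-1)/2} Res(C, C')  (= (-1)^{k(k-1)/2} ∏ C'(λ_i), C monic)

discC : (k : ℕ) → (Fin k → ℤ) → ℤ
discC k t =
  signPow ((k ℕ.* (k ∸ 1)) / 2) ℤ.* resultant k (coeffC k t) (k ∸ 1) (coeffC' k t)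

-- t_k (the last parameter); only used when k ≥ 1
tLast : (k : ℕ) → (Fin k → ℤ) → ℤ
tLast zero    t = + 0
tLast (suc m) t = t (Fin.fromℕ m)

{-# OPTIONS --safe #-}

-- Work modulo p. The reversal D = 1 - t₁x - … - t_k x^k of C satisfies D F = 1, and the rows of the
-- Sylvester matrix are the multiples x^r D and x^s E, where E = k D - θD (θ = x d/dx) is the
-- reversal of C′. A kernel vector of that matrix is a window of a series on which both D and θD act
-- as polynomials.
--
-- If p ∤ c, a series V for which D V and θD V are polynomials is eventually c-periodic, and so is
-- θV; hence c V(n + c) vanishes for large n. As t_k is a unit, the recurrence runs backwards and
-- V = 0, so the resultant is nonzero.
--
-- If p ∣ c and the resultant is nonzero, then F^j is eventually c-periodic for 1 ≤ j ≤ p, by induction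
-- on j: θ(F^j) = -j θD F^{j+1} and D F^{j+1} = F^j are both eventually c-periodic, and a nonsingular
-- Sylvester matrix transfers this to F^{j+1}. Since F^p = F(x^p), already c/p is a period of F.

module Submission where

open import Defs
open import Level using (0ℓ)
open import Algebra.Bundles using (CommutativeRing; CommutativeSemiring)
import Algebra.Properties.CommutativeSemiring.Binomial
import Algebra.Properties.CommutativeSemiring.Exp
import Algebra.Properties.CommutativeMonoid.Mult
import Algebra.Properties.Semiring.Mult
import Algebra.Properties.Semiring.Sum
open import Data.Bool using (if_then_else_)
open import Data.Nat as ℕ using (ℕ; zero; suc; _≤_; _<_; _≤?_; z≤n; s≤s; _∸_; NonZero)
import Data.Nat.Properties as ℕ
open import Data.Nat.Combinatorics using (_C_; nCk+nC[k+1]≡[n+1]C[k+1]; nCn≡1)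
open import Data.Nat.Coprimality using (Coprime; coprime-Bézout)
open import Data.Nat.Divisibility using (_∣_; divides; _∣?_; ∣⇒≤; ∣1⇒≡1; m∣m*n)
open import Data.Nat.GCD using (module Bézout)
open import Data.Nat.Induction using (<-rec)
open import Data.Nat.Primality
  using (Prime; euclidsLemma; prime⇒irreducible; prime⇒nonZero; prime⇒nonTrivial; ¬prime[1])
import Data.Nat.Tactic.RingSolver as ℕSolver
open import Data.Fin as Fin
  using (Fin; toℕ; fromℕ; fromℕ<; inject₁; opposite; punchIn; punchOut; funToFin; finToFun)
import Data.Fin.Properties as Fin
open import Data.Integer as ℤ using (ℤ; +_; -_; _+_; _*_; ∣_∣)
import Data.Integer.Properties as ℤ
import Data.Integer.DivMod as ℤ
open import Data.Integer.Divisibility using () renaming (_∣_ to _∣ℤ_)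
import Data.Integer.Divisibility.Signed as ℤ∣
open import Data.Integer.Tactic.RingSolver using (solve-∀)
open import Data.List using (List; []; _∷_; _++_; map)
open import Data.Product using (Σ; _×_; _,_; proj₁; proj₂; ∃; ∃₂)
open import Data.Sum using (_⊎_; inj₁; inj₂)
open import Data.Vec.Functional using (updateAt)
open import Data.Vec.Functional.Properties using (updateAt-updates; updateAt-minimal)
open import Function using (_∘_)
open import Function.Bundles using (_⇔_; mk⇔; module Equivalence)
open import Relation.Binary using (Setoid; tri<; tri≈; tri>)
open import Relation.Binary.PropositionalEquality hiding (setoid)
open import Relation.Nullary using (Dec; does; yes; no; ¬_; contradiction)
open import Relation.Nullary.Decidable using (dec-true; dec-false; map′; _×-dec_)
open import Relation.Unary using (Decidable)

-- The usual argument reads c as the order of the companion matrix and decides p ∣ c in a splitting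
-- field. No root of C is constructed here: separability enters only as invertibility of the
-- Sylvester matrix, periodicity only as vanishing of a shift difference Δ. Two obstacles shape the
-- argument. A kernel vector sees 2k - 1 coefficients while periodicity concerns all of them, so a
-- window has to be continued to a series; this uses that D 0 is a unit. And Δ commutes with
-- multiplication by a polynomial only past its degree, so intermediate claims hold only eventually;
-- that D k is a unit makes them hold from index 0. The exponent p is met from both sides: passing
-- from F^j to F^(j+1) divides by j, which is possible for j = 1, ..., p - 1, and F^p is the power
-- whose coefficients at multiples of p repeat those of F. The identities relating D, F and θ are
-- exact over ℤ; only vanishing is taken modulo p.

+-congˡ : ∀ x {y z} → y ≡ z → x + y ≡ x + z
+-congˡ x = cong (λ y → x + y)

-- The commutative ring of formal power series over ℤ

Series : Set
Series = ℕ → ℤ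

infix 4 _≐_
_≐_ : Series → Series → Set
f ≐ g = ∀ n → f n ≡ g n

tl : Series → Series
tl f n = f (suc n)

const : ℤ → Series
const a zero    = a
const a (suc _) = + 0

infixl 7 _⊛_
infixl 6 _⊞_
-- The recursion of (f 0 + x · tl f) · g, so that the ring laws are inductions on the index that
-- peel one coefficient off the left factor.
_⊛_ : Series → Series → Series
(f ⊛ g) zero    = f 0 * g 0
(f ⊛ g) (suc n) = f 0 * g (suc n) + (tl f ⊛ g) n

_⊞_ : Series → Series → Series
(f ⊞ g) n = f n + g n

⊟_ : Series → Series
(⊟ f) n = - f n

infixr 7 _∙_
_∙_ : ℤ → Series → Series
(a ∙ f) n = a * f n

⊛-cong : ∀ {f f' g g'} → f ≐ f' → g ≐ g' → f ⊛ g ≐ f' ⊛ g'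
⊛-cong e h zero    = cong₂ _*_ (e 0) (h 0)
⊛-cong e h (suc n) =
  cong₂ _+_ (cong₂ _*_ (e 0) (h (suc n))) (⊛-cong (e ∘ suc) h n)

⊛-distribʳ : ∀ h f g → (f ⊞ g) ⊛ h ≐ (f ⊛ h) ⊞ (g ⊛ h)
⊛-distribʳ h f g zero    = ℤ.*-distribʳ-+ (h 0) (f 0) (g 0)
⊛-distribʳ h f g (suc n) =
  trans (+-congˡ ((f 0 + g 0) * h (suc n)) (⊛-distribʳ h (tl f) (tl g) n))
        (lem (f 0) (g 0) (h (suc n)) ((tl f ⊛ h) n) ((tl g ⊛ h) n))
  where
  lem : ∀ a b c x y → (a + b) * c + (x + y) ≡ (a * c + x) + (b * c + y)
  lem = solve-∀

∙-⊛ : ∀ a f g → (a ∙ f) ⊛ g ≐ a ∙ (f ⊛ g)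
∙-⊛ a f g zero    = ℤ.*-assoc a (f 0) (g 0)
∙-⊛ a f g (suc n) =
  trans (+-congˡ ((a * f 0) * g (suc n)) (∙-⊛ a (tl f) g n))
        (lem a (f 0) (g (suc n)) ((tl f ⊛ g) n))
  where
  lem : ∀ a b c x → (a * b) * c + a * x ≡ a * (b * c + x)
  lem = solve-∀

⊛-assoc : ∀ f g h → (f ⊛ g) ⊛ h ≐ f ⊛ (g ⊛ h)
⊛-assoc f g h zero    = ℤ.*-assoc (f 0) (g 0) (h 0)
⊛-assoc f g h (suc n) = begin
  (f 0 * g 0) * h (suc n) + (((f 0 ∙ tl g) ⊞ (tl f ⊛ g)) ⊛ h) n
    ≡⟨ +-congˡ ((f 0 * g 0) * h (suc n)) (⊛-distribʳ h (f 0 ∙ tl g) (tl f ⊛ g) n) ⟩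
  (f 0 * g 0) * h (suc n) + (((f 0 ∙ tl g) ⊛ h) n + ((tl f ⊛ g) ⊛ h) n)
    ≡⟨ +-congˡ ((f 0 * g 0) * h (suc n)) (cong₂ _+_ (∙-⊛ (f 0) (tl g) h n) (⊛-assoc (tl f) g h n)) ⟩
  (f 0 * g 0) * h (suc n) + (f 0 * (tl g ⊛ h) n + (tl f ⊛ (g ⊛ h)) n)
    ≡⟨ lem (f 0) (g 0) (h (suc n)) ((tl g ⊛ h) n) ((tl f ⊛ (g ⊛ h)) n) ⟩
  f 0 * (g 0 * h (suc n) + (tl g ⊛ h) n) + (tl f ⊛ (g ⊛ h)) n ∎
  where
  open ≡-Reasoning
  lem : ∀ a b c x y → (a * b) * c + (a * x + y) ≡ a * (b * c + x) + y
  lem = solve-∀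

-- The mirror image of the defining clause, peeling the right factor; commutativity rests on it.
⊛-suc : ∀ f g n → (f ⊛ g) (suc n) ≡ g 0 * f (suc n) + (f ⊛ tl g) n
⊛-suc f g zero    = lem (f 0) (g 1) (f 1) (g 0)
  where
  lem : ∀ a b c d → a * b + c * d ≡ d * c + a * b
  lem = solve-∀
⊛-suc f g (suc n) =
  trans (+-congˡ (f 0 * g (suc (suc n))) (⊛-suc (tl f) g n))
        (lem (f 0 * g (suc (suc n))) (g 0 * f (suc (suc n))) ((tl f ⊛ tl g) n))
  where
  lem : ∀ a b c → a + (b + c) ≡ b + (a + c)
  lem = solve-∀

⊛-comm : ∀ f g → f ⊛ g ≐ g ⊛ f
⊛-comm f g zero    = ℤ.*-comm (f 0) (g 0)
⊛-comm f g (suc n) =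
  trans (⊛-suc f g n) (+-congˡ (g 0 * f (suc n)) (⊛-comm f (tl g) n))

𝟎-⊛ : ∀ f g → (∀ n → f n ≡ + 0) → ∀ n → (f ⊛ g) n ≡ + 0
𝟎-⊛ f g z zero    = cong (_* g 0) (z 0)
𝟎-⊛ f g z (suc n) = cong₂ _+_ (cong (_* g (suc n)) (z 0)) (𝟎-⊛ (tl f) g (z ∘ suc) n)

const-⊛ : ∀ a f → const a ⊛ f ≐ a ∙ f
const-⊛ a f zero    = refl
const-⊛ a f (suc n) =
  trans (+-congˡ (a * f (suc n)) (𝟎-⊛ (tl (const a)) f (λ _ → refl) n)) (ℤ.+-identityʳ _)

seriesRing : CommutativeRing 0ℓ 0ℓ
seriesRing = record
  { Carrier = Series
  ; _≈_ = _≐_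
  ; _+_ = _⊞_
  ; _*_ = _⊛_
  ; -_ = ⊟_
  ; 0# = λ _ → + 0
  ; 1# = const (+ 1)
  ; isCommutativeRing = record
    { isRing = record
      { +-isAbelianGroup = record
        { isGroup = record
          { isMonoid = record
            { isSemigroup = record
              { isMagma = record
                { isEquivalence = record
                  { refl = λ _ → refl
                  ; sym = λ e n → sym (e n)
                  ; trans = λ e h n → trans (e n) (h n)
                  }
                ; ∙-cong = λ e h n → cong₂ _+_ (e n) (h n)
                }
              ; assoc = λ f g h n → ℤ.+-assoc (f n) (g n) (h n)
              }
            ; identity = (λ f n → ℤ.+-identityˡ (f n)) , (λ f n → ℤ.+-identityʳ (f n))
            }
          ; inverse = (λ f n → ℤ.+-inverseˡ (f n)) , (λ f n → ℤ.+-inverseʳ (f n))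
          ; ⁻¹-cong = λ e n → cong -_ (e n)
          }
        ; comm = λ f g n → ℤ.+-comm (f n) (g n)
        }
      ; *-cong = ⊛-cong
      ; *-assoc = ⊛-assoc
      ; *-identity = identityˡ , λ f n → trans (⊛-comm f (const (+ 1)) n) (identityˡ f n)
      ; distrib = (λ h f g n → trans (⊛-comm h (f ⊞ g) n) (trans (⊛-distribʳ h f g n)
                     (cong₂ _+_ (⊛-comm f h n) (⊛-comm g h n))))
                , ⊛-distribʳ
      }
    ; *-comm = ⊛-comm
    }
  }
  where
  identityˡ : ∀ f → const (+ 1) ⊛ f ≐ f
  identityˡ f n = trans (const-⊛ (+ 1) f n) (ℤ.*-identityˡ (f n))

-- The Euler operator, windows and shift differences

θ : Series → Series
θ f n = + n * f n

-- The Leibniz rule. The induction closes because θ(x h) = x (h + θ h): the tail of `θ f` is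
-- `tl f ⊞ θ (tl f)`.
θ-⊛ : ∀ f g → θ (f ⊛ g) ≐ (θ f ⊛ g) ⊞ (f ⊛ θ g)
θ-⊛ f g zero    = lem (f 0) (g 0)
  where
  lem : ∀ a b → + 0 * (a * b) ≡ (+ 0 * a) * b + a * (+ 0 * b)
  lem = solve-∀
θ-⊛ f g (suc n) = begin
  + suc n * (f 0 * g (suc n) + (tl f ⊛ g) n)
    ≡⟨ lem₁ (+ n) (f 0) (g (suc n)) ((tl f ⊛ g) n) ⟩
  f 0 * (+ suc n * g (suc n)) + ((tl f ⊛ g) n + θ (tl f ⊛ g) n)
    ≡⟨ cong (λ z → f 0 * (+ suc n * g (suc n)) + ((tl f ⊛ g) n + z)) (θ-⊛ (tl f) g n) ⟩
  f 0 * (+ suc n * g (suc n)) + ((tl f ⊛ g) n + ((θ (tl f) ⊛ g) n + (tl f ⊛ θ g) n))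
    ≡⟨ lem₂ (f 0) (g (suc n)) (f 0 * (+ suc n * g (suc n))) ((tl f ⊛ g) n) ((θ (tl f) ⊛ g) n) ((tl f ⊛ θ g) n) ⟩
  ((+ 0 * f 0) * g (suc n) + ((tl f ⊛ g) n + (θ (tl f) ⊛ g) n))
    + (f 0 * (+ suc n * g (suc n)) + (tl f ⊛ θ g) n)
    ≡⟨ cong (λ z → ((+ 0 * f 0) * g (suc n) + z) + (f 0 * (+ suc n * g (suc n)) + (tl f ⊛ θ g) n))
         (⊛-distribʳ g (tl f) (θ (tl f)) n) ⟨
  ((+ 0 * f 0) * g (suc n) + ((tl f ⊞ θ (tl f)) ⊛ g) n)
    + (f 0 * (+ suc n * g (suc n)) + (tl f ⊛ θ g) n)
    ≡⟨ cong (λ z → ((+ 0 * f 0) * g (suc n) + z) + (f 0 * (+ suc n * g (suc n)) + (tl f ⊛ θ g) n))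
         (⊛-cong {f = tl f ⊞ θ (tl f)} {f' = tl (θ f)} {g = g} (λ i → lem₃ (+ i) (f (suc i))) (λ _ → refl) n) ⟩
  ((+ 0 * f 0) * g (suc n) + (tl (θ f) ⊛ g) n) + (f 0 * (+ suc n * g (suc n)) + (tl f ⊛ θ g) n) ∎
  where
  open ≡-Reasoning
  lem₁ : ∀ m a b c → (+ 1 + m) * (a * b + c) ≡ a * ((+ 1 + m) * b) + (c + m * c)
  lem₁ = solve-∀
  lem₂ : ∀ a b c x y z → c + (x + (y + z)) ≡ ((+ 0 * a) * b + (x + y)) + (c + z)
  lem₂ = solve-∀
  lem₃ : ∀ m a → a + m * a ≡ (+ 1 + m) * a
  lem₃ = solve-∀

sumFin-cong : ∀ {n} {f g : Fin n → ℤ} → (∀ i → f i ≡ g i) → sumFin f ≡ sumFin g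
sumFin-cong {zero}  e = refl
sumFin-cong {suc n} e = cong₂ _+_ (e Fin.zero) (sumFin-cong (e ∘ Fin.suc))

sumFin-zero : ∀ {n} {f : Fin n → ℤ} → (∀ i → f i ≡ + 0) → sumFin f ≡ + 0
sumFin-zero {zero}  e = refl
sumFin-zero {suc n} e = cong₂ _+_ (e Fin.zero) (sumFin-zero (e ∘ Fin.suc))

-- Read backwards from m, so that pairing a row of coefficients with it gives the coefficient of a
-- product at m.
window : ∀ L → Series → ℕ → Fin L → ℤ
window L g m i = g (m ∸ toℕ i)

Δ : ℕ → Series → Series
Δ c f n = f (n ℕ.+ c) ℤ.- f n

⊛-swap : ∀ f g h → f ⊛ (g ⊛ h) ≐ g ⊛ (f ⊛ h)
⊛-swap f g h n = trans (sym (⊛-assoc f g h n)) (trans (⊛-cong {g = h} (⊛-comm f g) (λ _ → refl) n) (⊛-assoc g f h n))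

1⊛ : ∀ f → const (+ 1) ⊛ f ≐ f
1⊛ f n = trans (const-⊛ (+ 1) f n) (ℤ.*-identityˡ (f n))

⊛-1 : ∀ f → f ⊛ const (+ 1) ≐ f
⊛-1 f n = trans (⊛-comm f (const (+ 1)) n) (1⊛ f n)

Δ-cong : ∀ c {f g} → f ≐ g → Δ c f ≐ Δ c g
Δ-cong c e n = cong₂ ℤ._-_ (e (n ℕ.+ c)) (e n)

-- The last term is where p meets c: for p ∣ c it drops out and θ preserves c-periodicity, while for
-- p ∤ c it exposes the values of f themselves.
Δ-θ : ∀ c f n → Δ c (θ f) n ≡ + n * Δ c f n + + c * f (n ℕ.+ c)
Δ-θ c f n = lem (+ n) (+ c) (f (n ℕ.+ c)) (f n)
  where
  lem : ∀ n c x y → (n + c) * x ℤ.- n * y ≡ n * (x ℤ.- y) + c * x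
  lem = solve-∀

open Algebra.Properties.CommutativeSemiring.Exp (CommutativeRing.commutativeSemiring ℤ.+-*-commutativeRing)
  using () renaming (_^_ to _^ᶻ_)
open Algebra.Properties.CommutativeSemiring.Exp (CommutativeRing.commutativeSemiring seriesRing)
  using (_^_; ^-distrib-*; ^-congˡ)
open Algebra.Properties.Semiring.Mult (CommutativeRing.semiring ℤ.+-*-commutativeRing) using () renaming (_×_ to _×ᶻ_)
open Algebra.Properties.Semiring.Mult (CommutativeRing.semiring seriesRing) using () renaming (_×_ to _×ˢ_)

⊛-∙ : ∀ a f g → f ⊛ (a ∙ g) ≐ a ∙ (f ⊛ g)
⊛-∙ a f g n = trans (⊛-comm f (a ∙ g) n) (trans (∙-⊛ a g f n) (cong (a *_) (⊛-comm g f n)))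

-- The Euler operator on powers of 1/D

module _ {D F : Series} (D⊛F≐1 : D ⊛ F ≐ const (+ 1)) where

  D⊛θF : D ⊛ θ F ≐ (- + 1) ∙ (θ D ⊛ F)
  D⊛θF n = begin
    (D ⊛ θ F) n                                              ≡⟨ lem ((θ D ⊛ F) n) ((D ⊛ θ F) n) ⟩
    ((θ D ⊛ F) n + (D ⊛ θ F) n) + - + 1 * (θ D ⊛ F) n        ≡⟨ cong (λ z → z + - + 1 * (θ D ⊛ F) n) (θ-⊛ D F n) ⟨
    + n * (D ⊛ F) n + - + 1 * (θ D ⊛ F) n                    ≡⟨ cong (λ z → + n * z + - + 1 * (θ D ⊛ F) n) (D⊛F≐1 n) ⟩
    + n * const (+ 1) n + - + 1 * (θ D ⊛ F) n                ≡⟨ cong (λ z → z + - + 1 * (θ D ⊛ F) n) (θ1 n) ⟩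
    + 0 + - + 1 * (θ D ⊛ F) n                                ≡⟨ ℤ.+-identityˡ (- + 1 * (θ D ⊛ F) n) ⟩
    - + 1 * (θ D ⊛ F) n                                      ∎
    where
    open ≡-Reasoning
    lem : ∀ a b → b ≡ (a + b) + - + 1 * a
    lem = solve-∀
    θ1 : ∀ n → + n * const (+ 1) n ≡ + 0
    θ1 zero    = refl
    θ1 (suc n) = ℤ.*-zeroʳ (+ suc n)

  D⊛[F⊛] : ∀ V → D ⊛ (F ⊛ V) ≐ V
  D⊛[F⊛] V n = trans (sym (⊛-assoc D F V n)) (trans (⊛-cong {g = V} D⊛F≐1 (λ _ → refl) n) (1⊛ V n))

  θF : θ F ≐ (- + 1) ∙ (θ D ⊛ (F ⊛ F))
  θF n = begin
    θ F n                                     ≡⟨ D⊛[F⊛] (θ F) n ⟨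
    (D ⊛ (F ⊛ θ F)) n                         ≡⟨ ⊛-swap D F (θ F) n ⟩
    (F ⊛ (D ⊛ θ F)) n                         ≡⟨ ⊛-cong {f = F} (λ _ → refl) D⊛θF n ⟩
    (F ⊛ ((- + 1) ∙ (θ D ⊛ F))) n             ≡⟨ ⊛-∙ (- + 1) F (θ D ⊛ F) n ⟩
    - + 1 * (F ⊛ (θ D ⊛ F)) n                 ≡⟨ cong (- + 1 *_) (⊛-swap F (θ D) F n) ⟩
    - + 1 * (θ D ⊛ (F ⊛ F)) n                 ∎
    where open ≡-Reasoning

  -- The power rule for D^(-j). The factor j is what has to be a unit modulo p when θD F^(j+1) is
  -- recovered from F^j.
  θ-^ : ∀ j → θ (F ^ j) ≐ (- + j) ∙ (θ D ⊛ F ^ suc j)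
  θ-^ zero    zero    = refl
  θ-^ zero    (suc n) = ℤ.*-zeroʳ (+ suc n)
  θ-^ (suc j) n = begin
    θ (F ⊛ G) n                                           ≡⟨ θ-⊛ F G n ⟩
    (θ F ⊛ G) n + (F ⊛ θ G) n                             ≡⟨ cong₂ _+_ first second ⟩
    - + 1 * (θ D ⊛ (F ⊛ (F ⊛ G))) n + - + j * (θ D ⊛ (F ⊛ (F ⊛ G))) n
      ≡⟨ lem (+ j) ((θ D ⊛ (F ⊛ (F ⊛ G))) n) ⟩
    - + suc j * (θ D ⊛ (F ⊛ (F ⊛ G))) n                   ∎
    where
    open ≡-Reasoning
    G : Series
    G = F ^ j
    lem : ∀ j x → - + 1 * x + - j * x ≡ - (+ 1 + j) * x
    lem = solve-∀
    first : (θ F ⊛ G) n ≡ - + 1 * (θ D ⊛ (F ⊛ (F ⊛ G))) n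
    first = begin
      (θ F ⊛ G) n                               ≡⟨ ⊛-cong {g = G} θF (λ _ → refl) n ⟩
      (((- + 1) ∙ (θ D ⊛ (F ⊛ F))) ⊛ G) n       ≡⟨ ∙-⊛ (- + 1) (θ D ⊛ (F ⊛ F)) G n ⟩
      - + 1 * ((θ D ⊛ (F ⊛ F)) ⊛ G) n           ≡⟨ cong (- + 1 *_) (⊛-assoc (θ D) (F ⊛ F) G n) ⟩
      - + 1 * (θ D ⊛ ((F ⊛ F) ⊛ G)) n           ≡⟨ cong (- + 1 *_) (⊛-cong {f = θ D} (λ _ → refl) (⊛-assoc F F G) n) ⟩
      - + 1 * (θ D ⊛ (F ⊛ (F ⊛ G))) n           ∎
    second : (F ⊛ θ G) n ≡ - + j * (θ D ⊛ (F ⊛ (F ⊛ G))) n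
    second = begin
      (F ⊛ θ G) n                               ≡⟨ ⊛-cong {f = F} (λ _ → refl) (θ-^ j) n ⟩
      (F ⊛ ((- + j) ∙ (θ D ⊛ (F ⊛ G)))) n       ≡⟨ ⊛-∙ (- + j) F (θ D ⊛ (F ⊛ G)) n ⟩
      - + j * (F ⊛ (θ D ⊛ (F ⊛ G))) n           ≡⟨ cong (- + j *_) (⊛-swap F (θ D) (F ⊛ G) n) ⟩
      - + j * (θ D ⊛ (F ⊛ (F ⊛ G))) n           ∎

-- Determinants and column operations

private variable m n : ℕ

Vector : ℕ → Set
Vector n = Fin n → ℤ

Matrix : ℕ → ℕ → Set
Matrix m n = Fin m → Vector n

dot : Vector n → Vector n → ℤ
dot u v = sumFin (λ i → u i * v i)

dot-congʳ : ∀ (u : Vector n) {v w : Vector n} → (∀ i → v i ≡ w i) → dot u v ≡ dot u w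
dot-congʳ u e = sumFin-cong (λ i → cong (u i *_) (e i))

sumFin-linear : ∀ {f g h : Vector n} a → (∀ i → f i ≡ g i + a * h i) →
  sumFin f ≡ sumFin g + a * sumFin h
sumFin-linear {zero}  a e = sym (trans (ℤ.+-identityˡ (a * + 0)) (ℤ.*-zeroʳ a))
sumFin-linear {suc n} {f} {g} {h} a e = begin
  f Fin.zero + sumFin (f ∘ Fin.suc)
    ≡⟨ cong₂ _+_ (e Fin.zero) (sumFin-linear a (e ∘ Fin.suc)) ⟩
  (g Fin.zero + a * h Fin.zero) + (sumFin (g ∘ Fin.suc) + a * sumFin (h ∘ Fin.suc))
    ≡⟨ lem (g Fin.zero) a (h Fin.zero) (sumFin (g ∘ Fin.suc)) (sumFin (h ∘ Fin.suc)) ⟩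
  (g Fin.zero + sumFin (g ∘ Fin.suc)) + a * (h Fin.zero + sumFin (h ∘ Fin.suc)) ∎
  where
  open ≡-Reasoning
  lem : ∀ x a y z w → (x + a * y) + (z + a * w) ≡ (x + z) + a * (y + w)
  lem = solve-∀

sumFin-pair : ∀ (i : Fin n) (f : Vector (suc n)) →
  (∀ c → c ≢ inject₁ i → c ≢ Fin.suc i → f c ≡ + 0) →
  f (inject₁ i) + f (Fin.suc i) ≡ + 0 → sumFin f ≡ + 0
sumFin-pair Fin.zero f z e = begin
  f₀ + (f₁ + r)   ≡⟨ ℤ.+-assoc f₀ f₁ r ⟨
  (f₀ + f₁) + r   ≡⟨ cong₂ _+_ e (sumFin-zero (λ c → z (Fin.suc (Fin.suc c)) (λ ()) (λ ()))) ⟩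
  + 0             ∎
  where
  open ≡-Reasoning
  f₀ = f Fin.zero
  f₁ = f (Fin.suc Fin.zero)
  r = sumFin (λ c → f (Fin.suc (Fin.suc c)))
sumFin-pair (Fin.suc i) f z e =
  cong₂ _+_ (z Fin.zero (λ ()) (λ ()))
    (sumFin-pair i (f ∘ Fin.suc)
      (λ c c≢ c≢' → z (Fin.suc c) (c≢ ∘ Fin.suc-injective) (c≢' ∘ Fin.suc-injective)) e)

minor : Matrix (suc n) (suc n) → Fin (suc n) → Matrix n n
minor M j r c = M (Fin.suc r) (punchIn j c)

laplaceTerm : Matrix (suc n) (suc n) → Vector (suc n)
laplaceTerm {n} M j = signPow (toℕ j) * (M Fin.zero j * det n (minor M j))

det-cong : {A B : Matrix n n} → (∀ r c → A r c ≡ B r c) → det n A ≡ det n B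
det-cong {zero}  e = refl
det-cong {suc n} e = sumFin-cong (λ j → cong (signPow (toℕ j) *_)
  (cong₂ _*_ (e Fin.zero j) (det-cong (λ r c → e (Fin.suc r) (punchIn j c)))))

-- In the expansion along the first row, the term at c = j carries the combination in its entry;
-- every other term carries it in its minor, where column j sits at `punchOut c≢j`.
det-linear : ∀ {A B Q : Matrix n n} j a →
  (∀ r → Q r j ≡ A r j + a * B r j) →
  (∀ r c → c ≢ j → Q r c ≡ A r c) →
  (∀ r c → c ≢ j → B r c ≡ A r c) →
  det n Q ≡ det n A + a * det n B
det-linear {suc n} {A} {B} {Q} j a on offQ offB =
  sumFin-linear {f = laplaceTerm Q} {laplaceTerm A} {laplaceTerm B} a term
  where
  open ≡-Reasoning
  lem₁ : ∀ s x a y d → s * ((x + a * y) * d) ≡ s * (x * d) + a * (s * (y * d))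
  lem₁ = solve-∀
  lem₂ : ∀ s x a y d → s * (x * (y + a * d)) ≡ s * (x * y) + a * (s * (x * d))
  lem₂ = solve-∀
  term : ∀ c → laplaceTerm Q c ≡ laplaceTerm A c + a * laplaceTerm B c
  term c with c Fin.≟ j
  ... | yes refl = begin
    s * (Q Fin.zero c * det n (minor Q c))
      ≡⟨ cong₂ (λ x y → s * (x * y)) (on Fin.zero) (det-cong (λ r x → offQ (Fin.suc r) (punchIn c x) (Fin.punchInᵢ≢i c x))) ⟩
    s * ((A Fin.zero c + a * B Fin.zero c) * det n (minor A c))
      ≡⟨ lem₁ s (A Fin.zero c) a (B Fin.zero c) (det n (minor A c)) ⟩
    laplaceTerm A c + a * (s * (B Fin.zero c * det n (minor A c)))
      ≡⟨ cong (λ x → laplaceTerm A c + a * (s * (B Fin.zero c * x)))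
           (det-cong (λ r x → offB (Fin.suc r) (punchIn c x) (Fin.punchInᵢ≢i c x))) ⟨
    laplaceTerm A c + a * laplaceTerm B c ∎
    where s = signPow (toℕ c)
  ... | no c≢j = begin
    s * (Q Fin.zero c * det n (minor Q c))
      ≡⟨ cong₂ (λ x y → s * (x * y)) (offQ Fin.zero c c≢j)
           (det-linear {A = minor A c} {minor B c} {minor Q c} j′ a on′
             (λ r x x≢ → offQ (Fin.suc r) (punchIn c x) (punchIn≢ x x≢))
             (λ r x x≢ → offB (Fin.suc r) (punchIn c x) (punchIn≢ x x≢))) ⟩
    s * (A Fin.zero c * (det n (minor A c) + a * det n (minor B c)))
      ≡⟨ lem₂ s (A Fin.zero c) a (det n (minor A c)) (det n (minor B c)) ⟩
    laplaceTerm A c + a * (s * (A Fin.zero c * det n (minor B c)))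
      ≡⟨ cong (λ x → laplaceTerm A c + a * (s * (x * det n (minor B c)))) (offB Fin.zero c c≢j) ⟨
    laplaceTerm A c + a * laplaceTerm B c ∎
    where
    s = signPow (toℕ c)
    j′ = punchOut c≢j
    c[j′] : punchIn c j′ ≡ j
    c[j′] = Fin.punchIn-punchOut c≢j
    on′ : ∀ r → minor Q c r j′ ≡ minor A c r j′ + a * minor B c r j′
    on′ r = subst (λ x → Q (Fin.suc r) x ≡ A (Fin.suc r) x + a * B (Fin.suc r) x) (sym c[j′]) (on (Fin.suc r))
    punchIn≢ : ∀ x → x ≢ j′ → punchIn c x ≢ j
    punchIn≢ x x≢ eq = x≢ (Fin.punchIn-injective c x j′ (trans eq (sym c[j′])))

punchIn-misses-adjacent : ∀ (i : Fin (suc n)) (c : Fin (suc (suc n))) →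
  c ≢ inject₁ i → c ≢ Fin.suc i →
  ∃ λ (j : Fin n) → punchIn c (inject₁ j) ≡ inject₁ i × punchIn c (Fin.suc j) ≡ Fin.suc i
punchIn-misses-adjacent Fin.zero Fin.zero c≢ c≢' = contradiction refl c≢
punchIn-misses-adjacent Fin.zero (Fin.suc Fin.zero) c≢ c≢' = contradiction refl c≢'
punchIn-misses-adjacent {suc n} Fin.zero (Fin.suc (Fin.suc c)) c≢ c≢' = Fin.zero , refl , refl
punchIn-misses-adjacent (Fin.suc i) Fin.zero c≢ c≢' = i , refl , refl
punchIn-misses-adjacent {suc n} (Fin.suc i) (Fin.suc c) c≢ c≢' =
  let j , e , e' = punchIn-misses-adjacent i c (c≢ ∘ cong Fin.suc) (c≢' ∘ cong Fin.suc)
  in Fin.suc j , cong Fin.suc e , cong Fin.suc e'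

punchIn-adjacent : ∀ (i : Fin n) (c : Fin n) →
  punchIn (inject₁ i) c ≡ punchIn (Fin.suc i) c
  ⊎ (punchIn (inject₁ i) c ≡ Fin.suc i × punchIn (Fin.suc i) c ≡ inject₁ i)
punchIn-adjacent Fin.zero Fin.zero = inj₂ (refl , refl)
punchIn-adjacent Fin.zero (Fin.suc c) = inj₁ refl
punchIn-adjacent (Fin.suc i) Fin.zero = inj₁ refl
punchIn-adjacent (Fin.suc i) (Fin.suc c) with punchIn-adjacent i c
... | inj₁ e = inj₁ (cong Fin.suc e)
... | inj₂ (e , e') = inj₂ (cong Fin.suc e , cong Fin.suc e')

-- Deleting any other column leaves the two equal ones adjacent, so that minor vanishes by
-- induction. The two remaining terms have equal entries and minors but opposite signs.
det-adjacent-equal : (i : Fin n) (M : Matrix (suc n) (suc n)) →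
  (∀ r → M r (inject₁ i) ≡ M r (Fin.suc i)) → det (suc n) M ≡ + 0
det-adjacent-equal {suc n} i M eq = sumFin-pair i (laplaceTerm M) others pair
  where
  open ≡-Reasoning
  others : ∀ c → c ≢ inject₁ i → c ≢ Fin.suc i → laplaceTerm M c ≡ + 0
  others c c≢ c≢' with punchIn-misses-adjacent i c c≢ c≢'
  ... | j , e , e' = begin
    s * (x * det (suc n) (minor M c))
      ≡⟨ cong (λ z → s * (x * z)) (det-adjacent-equal j (minor M c)
           (λ r → trans (cong (M (Fin.suc r)) e) (trans (eq (Fin.suc r)) (sym (cong (M (Fin.suc r)) e'))))) ⟩
    s * (x * + 0)   ≡⟨ lem s x ⟩
    + 0             ∎
    where
    s = signPow (toℕ c)
    x = M Fin.zero c
    lem : ∀ s x → s * (x * + 0) ≡ + 0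
    lem = solve-∀
  minors : ∀ r c → minor M (inject₁ i) r c ≡ minor M (Fin.suc i) r c
  minors r c with punchIn-adjacent i c
  ... | inj₁ e = cong (M (Fin.suc r)) e
  ... | inj₂ (e , e') = trans (cong (M (Fin.suc r)) e) (trans (sym (eq (Fin.suc r))) (sym (cong (M (Fin.suc r)) e')))
  pair : laplaceTerm M (inject₁ i) + laplaceTerm M (Fin.suc i) ≡ + 0
  pair = begin
    laplaceTerm M (inject₁ i) + laplaceTerm M (Fin.suc i)
      ≡⟨ cong (λ z → z + laplaceTerm M (Fin.suc i))
           (cong₂ _*_ (cong signPow (Fin.toℕ-inject₁ i)) (cong₂ _*_ (eq Fin.zero) (det-cong minors))) ⟩
    s * d + - s * d  ≡⟨ lem s d ⟩
    + 0              ∎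
    where
    s = signPow (toℕ i)
    d = M Fin.zero (Fin.suc i) * det (suc n) (minor M (Fin.suc i))
    lem : ∀ s d → s * d + - s * d ≡ + 0
    lem = solve-∀

-- Only adjacent entries interact: invariance of det under these operations follows from the first-row
-- expansion by induction, without signs of general permutations.

data Op (n : ℕ) : Set where
  up down : Fin n → ℤ → Op n

act : Op n → Vector (suc n) → Vector (suc n)
act (up Fin.zero a)      v Fin.zero = v Fin.zero + a * v (Fin.suc Fin.zero)
act (up Fin.zero a)      v (Fin.suc c) = v (Fin.suc c)
act (up (Fin.suc i) a)   v Fin.zero = v Fin.zero
act (up (Fin.suc i) a)   v (Fin.suc c) = act (up i a) (v ∘ Fin.suc) c
act (down Fin.zero a)    v Fin.zero = v Fin.zero
act (down Fin.zero a)    v (Fin.suc Fin.zero) = v (Fin.suc Fin.zero) + a * v Fin.zero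
act (down Fin.zero a)    v (Fin.suc (Fin.suc c)) = v (Fin.suc (Fin.suc c))
act (down (Fin.suc i) a) v Fin.zero = v Fin.zero
act (down (Fin.suc i) a) v (Fin.suc c) = act (down i a) (v ∘ Fin.suc) c

target source : Op n → Fin (suc n)
target (up i a)   = inject₁ i
target (down i a) = Fin.suc i
source (up i a)   = Fin.suc i
source (down i a) = inject₁ i

coeff : Op n → ℤ
coeff (up i a)   = a
coeff (down i a) = a

neg transpose : Op n → Op n
neg (up i a)   = up i (- a)
neg (down i a) = down i (- a)
transpose (up i a)   = down i a
transpose (down i a) = up i a

lift : Op n → Op (suc n)
lift (up i a)   = up (Fin.suc i) a
lift (down i a) = down (Fin.suc i) a

act-target : ∀ (o : Op n) v → act o v (target o) ≡ v (target o) + coeff o * v (source o)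
act-target (up Fin.zero a)      v = refl
act-target (up (Fin.suc i) a)   v = act-target (up i a) (v ∘ Fin.suc)
act-target (down Fin.zero a)    v = refl
act-target (down (Fin.suc i) a) v = act-target (down i a) (v ∘ Fin.suc)

act-other : ∀ (o : Op n) v c → c ≢ target o → act o v c ≡ v c
act-other (up Fin.zero a)      v Fin.zero c≢ = contradiction refl c≢
act-other (up Fin.zero a)      v (Fin.suc c) c≢ = refl
act-other (up (Fin.suc i) a)   v Fin.zero c≢ = refl
act-other (up (Fin.suc i) a)   v (Fin.suc c) c≢ = act-other (up i a) (v ∘ Fin.suc) c (c≢ ∘ cong Fin.suc)
act-other (down Fin.zero a)    v Fin.zero c≢ = refl
act-other (down Fin.zero a)    v (Fin.suc Fin.zero) c≢ = contradiction refl c≢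
act-other (down Fin.zero a)    v (Fin.suc (Fin.suc c)) c≢ = refl
act-other (down (Fin.suc i) a) v Fin.zero c≢ = refl
act-other (down (Fin.suc i) a) v (Fin.suc c) c≢ = act-other (down i a) (v ∘ Fin.suc) c (c≢ ∘ cong Fin.suc)

-- Only the target entry changes. The relation is left free so as to serve equality of vectors as
-- well as vanishing modulo p.
act-by : ∀ (P : ℤ → ℤ → Set) (o : Op n) (v w : Vector (suc n)) →
  P (v (target o) + coeff o * v (source o)) (w (target o)) →
  (∀ c → c ≢ target o → P (v c) (w c)) → ∀ c → P (act o v c) (w c)
act-by P o v w on off c with c Fin.≟ target o
... | yes refl = subst (λ x → P x (w c)) (sym (act-target o v)) on
... | no c≢ = subst (λ x → P x (w c)) (sym (act-other o v c c≢)) (off c c≢)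

inject₁≢suc : ∀ (i : Fin n) → inject₁ i ≢ Fin.suc i
inject₁≢suc (Fin.suc i) e = inject₁≢suc i (Fin.suc-injective e)

source≢target : ∀ (o : Op n) → source o ≢ target o
source≢target (up i a)   e = inject₁≢suc i (sym e)
source≢target (down i a) e = inject₁≢suc i e

act-cong : ∀ (o : Op n) {v w} → (∀ c → v c ≡ w c) → ∀ c → act o v c ≡ act o w c
act-cong o {v} {w} e = act-by _≡_ o v (act o w)
  (trans (cong₂ (λ x y → x + coeff o * y) (e (target o)) (e (source o))) (sym (act-target o w)))
  (λ c c≢ → trans (e c) (sym (act-other o w c c≢)))

coeff-neg : ∀ (o : Op n) → coeff (neg o) ≡ - coeff o
coeff-neg (up i a)   = refl
coeff-neg (down i a) = refl

target-neg : ∀ (o : Op n) → target (neg o) ≡ target o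
target-neg (up i a)   = refl
target-neg (down i a) = refl

source-neg : ∀ (o : Op n) → source (neg o) ≡ source o
source-neg (up i a)   = refl
source-neg (down i a) = refl

neg-involutive : ∀ (o : Op n) → neg (neg o) ≡ o
neg-involutive (up i a)   = cong (up i) (ℤ.neg-involutive a)
neg-involutive (down i a) = cong (down i) (ℤ.neg-involutive a)

act-neg : ∀ (o : Op n) v c → act (neg o) (act o v) c ≡ v c
act-neg o v = act-by _≡_ (neg o) (act o v) v on
  (λ c c≢ → act-other o v c (λ e → c≢ (trans e (sym (target-neg o)))))
  where
  open ≡-Reasoning
  x = v (target o)
  y = v (source o)
  a = coeff o
  lem : ∀ x y a → (x + a * y) + - a * y ≡ x
  lem = solve-∀
  on : act o v (target (neg o)) + coeff (neg o) * act o v (source (neg o)) ≡ v (target (neg o))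
  on rewrite target-neg o | source-neg o | coeff-neg o | act-target o v
           | act-other o v (source o) (source≢target o) = lem x y a

act-neg′ : ∀ (o : Op n) v c → act o (act (neg o) v) c ≡ v c
act-neg′ o v c = trans (cong (λ o′ → act o′ (act (neg o) v) c) (sym (neg-involutive o))) (act-neg (neg o) v c)

dot-act : ∀ (o : Op n) u v → dot (act o u) v ≡ dot u (act (transpose o) v)
dot-act (up Fin.zero a) u v = lem (u Fin.zero) (u (Fin.suc Fin.zero)) a (v Fin.zero) (v (Fin.suc Fin.zero))
    (sumFin (λ i → u (Fin.suc (Fin.suc i)) * v (Fin.suc (Fin.suc i))))
  where
  lem : ∀ u₀ u₁ a v₀ v₁ r → (u₀ + a * u₁) * v₀ + (u₁ * v₁ + r) ≡ u₀ * v₀ + (u₁ * (v₁ + a * v₀) + r)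
  lem = solve-∀
dot-act (up (Fin.suc i) a) u v = +-congˡ (u Fin.zero * v Fin.zero) (dot-act (up i a) (u ∘ Fin.suc) (v ∘ Fin.suc))
dot-act (down Fin.zero a) u v = lem (u Fin.zero) (u (Fin.suc Fin.zero)) a (v Fin.zero) (v (Fin.suc Fin.zero))
    (sumFin (λ i → u (Fin.suc (Fin.suc i)) * v (Fin.suc (Fin.suc i))))
  where
  lem : ∀ u₀ u₁ a v₀ v₁ r → u₀ * v₀ + ((u₁ + a * u₀) * v₁ + r) ≡ u₀ * (v₀ + a * v₁) + (u₁ * v₁ + r)
  lem = solve-∀
dot-act (down (Fin.suc i) a) u v = +-congˡ (u Fin.zero * v Fin.zero) (dot-act (down i a) (u ∘ Fin.suc) (v ∘ Fin.suc))

act-lift-suc : ∀ (o : Op n) v c → act (lift o) v (Fin.suc c) ≡ act o (v ∘ Fin.suc) c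
act-lift-suc (up i a)   v c = refl
act-lift-suc (down i a) v c = refl

-- By linearity in the target column the determinant changes by a multiple of det `B`, where `B` has
-- the source column in both places and the two places are adjacent.
det-act : ∀ (o : Op n) (M : Matrix (suc n) (suc n)) → det (suc n) (λ r → act o (M r)) ≡ det (suc n) M
det-act {n} o M = begin
  det (suc n) (λ r → act o (M r))
    ≡⟨ det-linear {A = M} {B} (target o) (coeff o)
         (λ r → trans (act-target o (M r)) (cong (λ z → M r (target o) + coeff o * z) (sym (B-target r))))
         (λ r → act-other o (M r)) B-other ⟩
  det (suc n) M + coeff o * det (suc n) B
    ≡⟨ cong (λ z → det (suc n) M + coeff o * z) (det-B o refl) ⟩
  det (suc n) M + coeff o * + 0
    ≡⟨ lem (det (suc n) M) (coeff o) ⟩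
  det (suc n) M ∎
  where
  open ≡-Reasoning
  lem : ∀ d a → d + a * + 0 ≡ d
  lem = solve-∀
  B : Matrix (suc n) (suc n)
  B r = updateAt (M r) (target o) (λ _ → M r (source o))
  B-target : ∀ r → B r (target o) ≡ M r (source o)
  B-target r = updateAt-updates (target o) (M r)
  B-other : ∀ r c → c ≢ target o → B r c ≡ M r c
  B-other r c c≢ = updateAt-minimal c (target o) (M r) c≢
  B-equal : ∀ r → B r (target o) ≡ B r (source o)
  B-equal r = trans (B-target r) (sym (B-other r (source o) (source≢target o)))
  det-B : ∀ o′ → o′ ≡ o → det (suc n) B ≡ + 0
  det-B (up i a)   refl = det-adjacent-equal i B B-equal
  det-B (down i a) refl = det-adjacent-equal i B (sym ∘ B-equal)

actAll : List (Op n) → Vector (suc n) → Vector (suc n)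
actAll []       v = v
actAll (o ∷ os) v = actAll os (act o v)

actAllᵀ : List (Op n) → Vector (suc n) → Vector (suc n)
actAllᵀ []       v = v
actAllᵀ (o ∷ os) v = act (transpose o) (actAllᵀ os v)

det-actAll : ∀ os (M : Matrix (suc n) (suc n)) → det (suc n) (λ r → actAll os (M r)) ≡ det (suc n) M
det-actAll []       M = refl
det-actAll (o ∷ os) M = trans (det-actAll os (λ r → act o (M r))) (det-act o M)

-- Column operations on a matrix amount to an invertible change of variables in its kernel; this
-- translates kernel vectors in both directions.
dot-actAll : ∀ (os : List (Op n)) u v → dot (actAll os u) v ≡ dot u (actAllᵀ os v)
dot-actAll []       u v = refl
dot-actAll (o ∷ os) u v = trans (dot-actAll os (act o u) v) (dot-act o u (actAllᵀ os v))

actAllᵀ-surjective : ∀ (os : List (Op n)) v → ∃ λ w → ∀ c → actAllᵀ os w c ≡ v c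
actAllᵀ-surjective []       v = v , λ _ → refl
actAllᵀ-surjective (o ∷ os) v with actAllᵀ-surjective os (act (neg (transpose o)) v)
... | w , e = w , λ c → trans (act-cong (transpose o) e c) (act-neg′ (transpose o) v c)

actAll-++ : ∀ (os os′ : List (Op n)) v → actAll (os ++ os′) v ≡ actAll os′ (actAll os v)
actAll-++ []       os′ v = refl
actAll-++ (o ∷ os) os′ v = actAll-++ os os′ (act o v)

actAll-cong : ∀ (os : List (Op n)) {v w} → (∀ c → v c ≡ w c) → ∀ c → actAll os v c ≡ actAll os w c
actAll-cong []       e = e
actAll-cong (o ∷ os) e = actAll-cong os (act-cong o e)

actAll-lift : ∀ (os : List (Op n)) v c → actAll (map lift os) v (Fin.suc c) ≡ actAll os (v ∘ Fin.suc) c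
actAll-lift []       v c = refl
actAll-lift (o ∷ os) v c =
  trans (actAll-lift os (act (lift o) v) c) (actAll-cong os (act-lift-suc o v) c)

zeroCons : Vector n → Vector (suc n)
zeroCons v Fin.zero    = + 0
zeroCons v (Fin.suc c) = v c

dot-zeroCons : ∀ (u : Vector (suc n)) v → dot u (zeroCons v) ≡ dot (u ∘ Fin.suc) v
dot-zeroCons u v = trans (cong (λ x → x + dot (u ∘ Fin.suc) v) (ℤ.*-zeroʳ (u Fin.zero)))
                         (ℤ.+-identityˡ (dot (u ∘ Fin.suc) v))

-- The recurrence as D F = 1

-- the reversal x^d a(1/x), truncated at degree d
rev : ℕ → Series → Series
rev d a n = if does (n ≤? d) then a (d ∸ n) else + 0

-- shift r f is x^r f; so band d a r is definitionally shift r (rev d a)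
shift : ℕ → Series → Series
shift r f n = if does (r ≤? n) then f (n ∸ r) else + 0

rev-≤ : ∀ d a {n} → n ≤ d → rev d a n ≡ a (d ∸ n)
rev-≤ d a {n} n≤d rewrite dec-true (n ≤? d) n≤d = refl

rev-> : ∀ d a {n} → d < n → rev d a n ≡ + 0
rev-> d a {n} d<n rewrite dec-false (n ≤? d) (ℕ.<⇒≱ d<n) = refl

shift-> : ∀ r f {d} → (∀ n → d < n → f n ≡ + 0) → ∀ n → d ℕ.+ r < n → shift r f n ≡ + 0
shift-> r f {d} z n d+r<n rewrite dec-true (r ≤? n) (ℕ.≤-trans (ℕ.m≤n+m r d) (ℕ.<⇒≤ d+r<n)) =
  z (n ∸ r) (ℕ.m+n≤o⇒m≤o∸n (suc d) d+r<n)

tl-shift : ∀ r f → tl (shift (suc r) f) ≐ shift r f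
tl-shift zero    f n = refl
tl-shift (suc r) f n = refl

shift-⊛ : ∀ r f g {m} → r ≤ m → (shift r f ⊛ g) m ≡ (f ⊛ g) (m ∸ r)
shift-⊛ zero    f g {m} z≤n = ⊛-cong {f = shift 0 f} {f} {g} (λ _ → refl) (λ _ → refl) m
shift-⊛ (suc r) f g {suc m} (s≤s r≤m) = begin
  + 0 * g (suc m) + (tl (shift (suc r) f) ⊛ g) m ≡⟨ ℤ.+-identityˡ ((tl (shift (suc r) f) ⊛ g) m) ⟩
  (tl (shift (suc r) f) ⊛ g) m ≡⟨ ⊛-cong {g = g} (tl-shift r f) (λ _ → refl) m ⟩
  (shift r f ⊛ g) m            ≡⟨ shift-⊛ r f g r≤m ⟩
  (f ⊛ g) (m ∸ r)              ∎
  where open ≡-Reasoning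

-- Also valid for n < l: entries before time 0 read as the default of `nth0`, which encodes the zero
-- initial values.
⊛-history : ∀ k t l (g : Series) → (∀ n → l ≤ n → g n ≡ + 0) → ∀ n →
  (g ⊛ F k t) n ≡ sumFin (λ (i : Fin l) → g (toℕ i) * nth0 (history k t n) (toℕ i))
⊛-history k t zero    g z n = 𝟎-⊛ g (F k t) (λ i → z i z≤n) n
⊛-history k t (suc l) g z zero = begin
  g 0 * + 1         ≡⟨ ℤ.+-identityʳ (g 0 * + 1) ⟨
  g 0 * + 1 + + 0   ≡⟨ +-congˡ (g 0 * + 1) (sumFin-zero {f = λ (i : Fin l) → g (suc (toℕ i)) * + 0} (λ i → ℤ.*-zeroʳ (g (suc (toℕ i))))) ⟨
  g 0 * + 1 + sumFin (λ (i : Fin l) → g (suc (toℕ i)) * + 0) ∎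
  where open ≡-Reasoning
⊛-history k t (suc l) g z (suc n) =
  +-congˡ (g 0 * F k t (suc n)) (⊛-history k t l (tl g) (λ i l≤i → z (suc i) (s≤s l≤i)) n)

coeffC-top : ∀ k t → coeffC k t k ≡ + 1
coeffC-top k t with ℕ.<-cmp k k
... | tri< _ k≢k _ = contradiction refl k≢k
... | tri≈ _ _ _   = refl
... | tri> _ k≢k _ = contradiction refl k≢k

coeffC-< : ∀ k t {i} (i<k : i < k) → coeffC k t i ≡ - t (opposite (fromℕ< i<k))
coeffC-< k t {i} i<k with ℕ.<-cmp i k
... | tri< i<k′ _ _ = cong (λ (x : i < k) → - t (opposite (fromℕ< x))) (ℕ.<-irrelevant i<k′ i<k)
... | tri≈ i≮k _ _  = contradiction i<k i≮k
... | tri> i≮k _ _  = contradiction i<k i≮k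

module Recurrence (k′ : ℕ) (t : Fin (suc k′) → ℤ) where

  k : ℕ
  k = suc k′

  -- D = 1 - t₁ x - … - t_k x^k is the reversal of C, and E that of C′
  D E : Series
  D = rev k (coeffC k t)
  E = rev k′ (coeffC' k t)

  D-zero : D 0 ≡ + 1
  D-zero = coeffC-top k t

  D-> : ∀ n → k < n → D n ≡ + 0
  D-> n = rev-> k (coeffC k t)

  E-> : ∀ n → k′ < n → E n ≡ + 0
  E-> n = rev-> k′ (coeffC' k t)

  D-suc : ∀ (i : Fin k) → D (suc (toℕ i)) ≡ - t i
  D-suc i = begin
    D (suc (toℕ i))                    ≡⟨ rev-≤ k (coeffC k t) (Fin.toℕ<n i) ⟩
    coeffC k t (k′ ∸ toℕ i)            ≡⟨ coeffC-< k t i<k ⟩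
    - t (opposite (fromℕ< i<k))        ≡⟨ cong (λ j → - t j) (Fin.toℕ-injective (begin
        toℕ (opposite (fromℕ< i<k))    ≡⟨ Fin.opposite-prop (fromℕ< i<k) ⟩
        k′ ∸ toℕ (fromℕ< i<k)          ≡⟨ cong (k′ ∸_) (Fin.toℕ-fromℕ< i<k) ⟩
        k′ ∸ (k′ ∸ toℕ i)              ≡⟨ ℕ.m∸[m∸n]≡n (ℕ.≤-pred (Fin.toℕ<n i)) ⟩
        toℕ i                          ∎)) ⟩
    - t i                              ∎
    where
    open ≡-Reasoning
    i<k : k′ ∸ toℕ i < k
    i<k = s≤s (ℕ.m∸n≤m k′ (toℕ i))

  D-top : D k ≡ - tLast k t
  D-top = trans (cong (λ j → D (suc j)) (sym (Fin.toℕ-fromℕ k′))) (D-suc (Fin.fromℕ k′))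

  -- The coefficient of x^n in D belongs to X^(k-n), which differentiation multiplies by k - n. At n
  -- = k this factor is 0, matching the cut-off of `rev k′`.
  E≐kD-θD : E ≐ (+ k ∙ D) ⊞ ((- + 1) ∙ θ D)
  E≐kD-θD n with n ≤? k′
  ... | yes n≤k′ = begin
    E n                                              ≡⟨ rev-≤ k′ (coeffC' k t) n≤k′ ⟩
    + suc (k′ ∸ n) * coeffC k t (suc (k′ ∸ n))       ≡⟨ cong (λ j → + j * coeffC k t j) (ℕ.+-∸-assoc 1 n≤k′) ⟨
    + (k ∸ n) * coeffC k t (k ∸ n)                   ≡⟨ cong₂ _*_ k∸n (sym (rev-≤ k (coeffC k t) n≤k)) ⟩
    (+ k ℤ.- + n) * D n                              ≡⟨ lem (+ k) (+ n) (D n) ⟩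
    + k * D n + - + 1 * (+ n * D n)                  ∎
    where
    open ≡-Reasoning
    n≤k : n ≤ k
    n≤k = ℕ.m≤n⇒m≤1+n n≤k′
    k∸n : + (k ∸ n) ≡ + k ℤ.- + n
    k∸n = trans (sym (ℤ.⊖-≥ n≤k)) (sym (ℤ.m-n≡m⊖n k n))
    lem : ∀ k n d → (k ℤ.- n) * d ≡ k * d + - + 1 * (n * d)
    lem = solve-∀
  ... | no n≰k′ with n ℕ.≟ k
  ...   | yes refl = trans (E-> k (ℕ.≰⇒> n≰k′)) (lem (+ k) (D k))
    where
    lem : ∀ k d → + 0 ≡ k * d + - + 1 * (k * d)
    lem = solve-∀
  ...   | no n≢k = trans (E-> n (ℕ.≰⇒> n≰k′))
            (trans (lem (+ k) (+ n)) (cong (λ d → + k * d + - + 1 * (+ n * d)) (sym (D-> n (ℕ.≤∧≢⇒< (ℕ.≰⇒> n≰k′) (n≢k ∘ sym))))))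
    where
    lem : ∀ k n → + 0 ≡ k * + 0 + - + 1 * (n * + 0)
    lem = solve-∀

  D⊛F≐1 : D ⊛ F k t ≐ const (+ 1)
  D⊛F≐1 zero    = cong (_* + 1) D-zero
  D⊛F≐1 (suc n) = begin
    D 0 * F k t (suc n) + (tl D ⊛ F k t) n
      ≡⟨ cong₂ (λ x y → x * F k t (suc n) + y) D-zero
           (⊛-history k t k (tl D) (λ i k≤i → D-> (suc i) (s≤s k≤i)) n) ⟩
    + 1 * s + sumFin (λ (i : Fin k) → D (suc (toℕ i)) * h i)
      ≡⟨ cong₂ _+_ (ℤ.*-identityˡ s) (trans
           (sumFin-linear {f = λ i → D (suc (toℕ i)) * h i} {λ _ → + 0} {λ i → t i * h i} (- + 1) (λ i → trans (cong (_* h i) (D-suc i)) (lem₁ (t i) (h i))))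
           (cong (λ z → z + - + 1 * s) (sumFin-zero {k} {λ _ → + 0} (λ _ → refl)))) ⟩
    s + (+ 0 + - + 1 * s) ≡⟨ lem₂ s ⟩
    + 0 ∎
    where
    open ≡-Reasoning
    h : Fin k → ℤ
    h i = nth0 (history k t n) (toℕ i)
    s = F k t (suc n)
    lem₁ : ∀ a b → - a * b ≡ + 0 + - + 1 * (a * b)
    lem₁ = solve-∀
    lem₂ : ∀ s → s + (+ 0 + - + 1 * s) ≡ + 0
    lem₂ = solve-∀

-- Finite vectors as series, binomial coefficients, powers of x

-- junk value 0 beyond the length
extend : ∀ {n} → Vector n → Series
extend {zero}  v _       = + 0
extend {suc n} v zero    = v Fin.zero
extend {suc n} v (suc i) = extend (v ∘ Fin.suc) i

extend-toℕ : ∀ {n} (v : Vector n) i → extend v (toℕ i) ≡ v i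
extend-toℕ v Fin.zero    = refl
extend-toℕ v (Fin.suc i) = extend-toℕ (v ∘ Fin.suc) i

truncate : ℕ → Series → Series
truncate k f n = if does (suc n ≤? k) then f n else + 0

truncate-< : ∀ k f {n} → n < k → truncate k f n ≡ f n
truncate-< k f {n} n<k rewrite dec-true (suc n ≤? k) n<k = refl

truncate-≥ : ∀ k f {n} → k ≤ n → truncate k f n ≡ + 0
truncate-≥ k f {n} k≤n rewrite dec-false (suc n ≤? k) (ℕ.≤⇒≯ k≤n) = refl

-- The absorption identity. With n + 1 = p it displays a factor p, whence p divides the inner
-- binomial coefficients.
[k+1]*[n+1]C[k+1]≡[n+1]*nCk : ∀ n k → suc k ℕ.* (suc n C suc k) ≡ suc n ℕ.* (n C k)
[k+1]*[n+1]C[k+1]≡[n+1]*nCk zero    zero    = refl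
[k+1]*[n+1]C[k+1]≡[n+1]*nCk zero    (suc k) = ℕ.*-zeroʳ k
[k+1]*[n+1]C[k+1]≡[n+1]*nCk (suc n) zero    = begin
  1 ℕ.* (suc (suc n) C 1)        ≡⟨ cong (1 ℕ.*_) (nCk+nC[k+1]≡[n+1]C[k+1] (suc n) 0) ⟨
  1 ℕ.* (1 ℕ.+ (suc n C 1))      ≡⟨ ℕ.*-distribˡ-+ 1 1 (suc n C 1) ⟩
  1 ℕ.+ 1 ℕ.* (suc n C 1)        ≡⟨ cong suc ([k+1]*[n+1]C[k+1]≡[n+1]*nCk n zero) ⟩
  suc (suc n) ℕ.* 1              ∎
  where open ≡-Reasoning
[k+1]*[n+1]C[k+1]≡[n+1]*nCk (suc n) (suc k) = begin
  suc (suc k) ℕ.* (suc (suc n) C suc (suc k))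
    ≡⟨ cong (suc (suc k) ℕ.*_) (nCk+nC[k+1]≡[n+1]C[k+1] (suc n) (suc k)) ⟨
  suc (suc k) ℕ.* (x ℕ.+ (suc n C suc (suc k)))
    ≡⟨ lem₁ k x (suc n C suc (suc k)) ⟩
  x ℕ.+ (suc k ℕ.* x ℕ.+ suc (suc k) ℕ.* (suc n C suc (suc k)))
    ≡⟨ cong (x ℕ.+_) (cong₂ ℕ._+_ ([k+1]*[n+1]C[k+1]≡[n+1]*nCk n k) ([k+1]*[n+1]C[k+1]≡[n+1]*nCk n (suc k))) ⟩
  x ℕ.+ (suc n ℕ.* (n C k) ℕ.+ suc n ℕ.* (n C suc k))
    ≡⟨ cong (x ℕ.+_) (ℕ.*-distribˡ-+ (suc n) (n C k) (n C suc k)) ⟨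
  x ℕ.+ suc n ℕ.* ((n C k) ℕ.+ (n C suc k))
    ≡⟨ cong (λ y → x ℕ.+ suc n ℕ.* y) (nCk+nC[k+1]≡[n+1]C[k+1] n k) ⟩
  suc (suc n) ℕ.* x ∎
  where
  open ≡-Reasoning
  x = suc n C suc k
  lem₁ : ∀ k x y → suc (suc k) ℕ.* (x ℕ.+ y) ≡ x ℕ.+ (suc k ℕ.* x ℕ.+ suc (suc k) ℕ.* y)
  lem₁ = ℕSolver.solve-∀

×ᶻ≡* : ∀ n a → n ×ᶻ a ≡ + n * a
×ᶻ≡* zero    a = sym (ℤ.*-zeroˡ a)
×ᶻ≡* (suc n) a = trans (+-congˡ a (×ᶻ≡* n a)) (lem (+ n) a)
  where
  lem : ∀ n a → a + n * a ≡ (+ 1 + n) * a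
  lem = solve-∀

×ˢ≐∙ : ∀ n f → n ×ˢ f ≐ + n ∙ f
×ˢ≐∙ zero    f i = sym (ℤ.*-zeroˡ (f i))
×ˢ≐∙ (suc n) f i = trans (+-congˡ (f i) (×ˢ≐∙ n f i)) (lem (+ n) (f i))
  where
  lem : ∀ n a → a + n * a ≡ (+ 1 + n) * a
  lem = solve-∀

const-^ : ∀ a n → const a ^ n ≐ const (a ^ᶻ n)
const-^ a zero    i = refl
const-^ a (suc n) i = trans (const-⊛ a (const a ^ n) i) (trans (cong (a *_) (const-^ a n i)) (lem i))
  where
  lem : ∀ i → a * const (a ^ᶻ n) i ≡ const (a * a ^ᶻ n) i
  lem zero    = refl
  lem (suc i) = ℤ.*-zeroʳ a

X : Series
X = shift 1 (const (+ 1))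

X⊛-suc : ∀ f n → (X ⊛ f) (suc n) ≡ f n
X⊛-suc f n = trans (shift-⊛ 1 (const (+ 1)) f {suc n} (s≤s z≤n)) (1⊛ f n)

X^⊛ : ∀ r f n → (X ^ r ⊛ f) (r ℕ.+ n) ≡ f n
X^⊛ zero    f n = 1⊛ f n
X^⊛ (suc r) f n = trans (⊛-assoc X (X ^ r) f (suc r ℕ.+ n)) (trans (X⊛-suc (X ^ r ⊛ f) (r ℕ.+ n)) (X^⊛ r f n))

const⊞X⊛tl : ∀ f → f ≐ const (f 0) ⊞ (X ⊛ tl f)
const⊞X⊛tl f zero    = sym (ℤ.+-identityʳ (f 0))
const⊞X⊛tl f (suc n) = sym (trans (ℤ.+-identityˡ ((X ⊛ tl f) (suc n))) (X⊛-suc (tl f) n))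

least : ∀ {P : ℕ → Set} → Decidable P → ∀ n → P n → ∃ λ m → P m × ∀ i → P i → m ≤ i
least {P} P? = <-rec _ step
  where
  step : ∀ n → (∀ {i} → i < n → P i → ∃ λ m → P m × ∀ i → P i → m ≤ i) → P n → ∃ λ m → P m × ∀ i → P i → m ≤ i
  step n rec pn with ℕ.anyUpTo? P? n
  ... | yes (i , i<n , pi) = rec i<n pi
  ... | no none = n , pn , λ i pi → ℕ.≮⇒≥ (λ i<n → none (i , i<n , pi))

signPow-square : ∀ n → signPow n * signPow n ≡ + 1
signPow-square zero    = refl
signPow-square (suc n) = trans (lem (signPow n)) (signPow-square n)
  where
  lem : ∀ a → - a * - a ≡ a * a
  lem = solve-∀

-- Integer arithmetic modulo a prime

module Modulo (p : ℕ) (p-prime : Prime p) where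

  infix 4 _≈_ _≈?_
  -- Storing the quotient turns each law of congruence into a ring identity.
  record _≈_ (a b : ℤ) : Set where
    constructor congruent
    field
      quotient : ℤ
      equality : a ≡ b + quotient * + p

  ≡⇒≈ : ∀ {a b} → a ≡ b → a ≈ b
  ≡⇒≈ {a} refl = congruent (+ 0) (lem a (+ p))
    where
    lem : ∀ a p → a ≡ a + + 0 * p
    lem = solve-∀

  ≈-refl : ∀ {a} → a ≈ a
  ≈-refl = ≡⇒≈ refl

  ≈-sym : ∀ {a b} → a ≈ b → b ≈ a
  ≈-sym {b = b} (congruent q refl) = congruent (- q) (lem b q (+ p))
    where
    lem : ∀ b q p → b ≡ (b + q * p) + - q * p
    lem = solve-∀

  ≈-trans : ∀ {a b c} → a ≈ b → b ≈ c → a ≈ c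
  ≈-trans {c = c} (congruent q refl) (congruent r refl) = congruent (r + q) (lem c r q (+ p))
    where
    lem : ∀ c r q p → (c + r * p) + q * p ≡ c + (r + q) * p
    lem = solve-∀

  ≈-setoid : Setoid 0ℓ 0ℓ
  ≈-setoid = record
    { Carrier = ℤ
    ; _≈_ = _≈_
    ; isEquivalence = record { refl = ≈-refl ; sym = ≈-sym ; trans = ≈-trans }
    }

  module ≈-Reasoning where
    open import Relation.Binary.Reasoning.Setoid ≈-setoid public

  +-cong : ∀ {a b c d} → a ≈ b → c ≈ d → a + c ≈ b + d
  +-cong {b = b} {d = d} (congruent q refl) (congruent r refl) =
    congruent (q + r) (lem b d q r (+ p))
    where
    lem : ∀ b d q r p → (b + q * p) + (d + r * p) ≡ (b + d) + (q + r) * p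
    lem = solve-∀

  *-cong : ∀ {a b c d} → a ≈ b → c ≈ d → a * c ≈ b * d
  *-cong {b = b} {d = d} (congruent q refl) (congruent r refl) =
    congruent (q * d + b * r + q * r * + p) (lem b d q r (+ p))
    where
    lem : ∀ b d q r p →
      (b + q * p) * (d + r * p) ≡ b * d + (q * d + b * r + q * r * p) * p
    lem = solve-∀

  -‿cong : ∀ {a b} → a ≈ b → - a ≈ - b
  -‿cong {b = b} (congruent q refl) = congruent (- q) (lem b q (+ p))
    where
    lem : ∀ b q p → - (b + q * p) ≡ - b + - q * p
    lem = solve-∀

  +-zero : ∀ {a b} → a ≈ + 0 → b ≈ + 0 → a + b ≈ + 0
  +-zero = +-cong

  *-zeroˡ : ∀ {a} b → a ≈ + 0 → a * b ≈ + 0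
  *-zeroˡ b e = *-cong e (≈-refl {b})

  *-zeroʳ : ∀ a {b} → b ≈ + 0 → a * b ≈ + 0
  *-zeroʳ a e = ≈-trans (*-cong (≈-refl {a}) e) (≡⇒≈ (ℤ.*-zeroʳ a))

  sumFin≈0 : ∀ {n} {f : Fin n → ℤ} → (∀ i → f i ≈ + 0) → sumFin f ≈ + 0
  sumFin≈0 {zero}  e = ≈-refl
  sumFin≈0 {suc n} e = +-zero (e Fin.zero) (sumFin≈0 (e ∘ Fin.suc))

  a-b≈0⇒a≈b : ∀ {a b} → a ℤ.- b ≈ + 0 → a ≈ b
  a-b≈0⇒a≈b {a} {b} e = ≈-trans (≡⇒≈ (lem a b)) (≈-trans (+-cong e (≈-refl {b})) (≡⇒≈ (ℤ.+-identityˡ b)))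
    where
    lem : ∀ a b → a ≡ (a ℤ.- b) + b
    lem = solve-∀

  a≈b⇒a-b≈0 : ∀ {a b} → a ≈ b → a ℤ.- b ≈ + 0
  a≈b⇒a-b≈0 {a} {b} e = ≈-trans (+-cong e (≈-refl { - b})) (≡⇒≈ (ℤ.+-inverseʳ b))

  ∣⇒≈0 : ∀ {a} → (+ p) ∣ℤ a → a ≈ + 0
  ∣⇒≈0 p∣a with ℤ∣.∣ᵤ⇒∣ p∣a
  ... | ℤ∣.divides q eq = congruent q (trans eq (sym (ℤ.+-identityˡ _)))

  ≈0⇒∣ : ∀ {a} → a ≈ + 0 → (+ p) ∣ℤ a
  ≈0⇒∣ (congruent q eq) = ℤ∣.∣⇒∣ᵤ (ℤ∣.divides q (trans eq (ℤ.+-identityˡ _)))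

  mod⇒≈ : ∀ {a b} → a ≡ b [mod p ] → a ≈ b
  mod⇒≈ = a-b≈0⇒a≈b ∘ ∣⇒≈0

  ≈⇒mod : ∀ {a b} → a ≈ b → a ≡ b [mod p ]
  ≈⇒mod = ≈0⇒∣ ∘ a≈b⇒a-b≈0

  _≈?_ : ∀ a b → Dec (a ≈ b)
  a ≈? b = map′ mod⇒≈ ≈⇒mod (p ∣? ∣ a ℤ.- b ∣)

  1≉0 : ¬ + 1 ≈ + 0
  1≉0 e = ¬prime[1] (subst Prime (∣1⇒≡1 (≈0⇒∣ e)) p-prime)

  private
    ℕ-inverse : ∀ n → ¬ + n ≈ + 0 → ∃ λ b → + n * b ≈ + 1
    ℕ-inverse n n≉0 with coprime-Bézout coprime
      where
      coprime : Coprime n p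
      coprime (d∣n , d∣p) with prime⇒irreducible p-prime d∣p
      ... | inj₁ d≡1 = d≡1
      ... | inj₂ refl = contradiction (∣⇒≈0 d∣n) n≉0
    ... | Bézout.+- x y eq = + x , congruent (+ y) (begin
      + n * + x       ≡⟨ ℤ.*-comm (+ n) (+ x) ⟩
      + x * + n       ≡⟨ ℤ.pos-* x n ⟨
      + (x ℕ.* n)     ≡⟨ cong +_ eq ⟨
      + 1 + + (y ℕ.* p) ≡⟨ +-congˡ (+ 1) (ℤ.pos-* y p) ⟩
      + 1 + + y * + p ∎)
      where open ≡-Reasoning
    ... | Bézout.-+ x y eq = - + x , congruent (- + y) (begin
      + n * - + x                          ≡⟨ lem (+ n) (+ x) ⟩
      + 1 + - (+ 1 + + x * + n)            ≡⟨ +-congˡ (+ 1) (cong (λ z → - (+ 1 + z)) (ℤ.pos-* x n)) ⟨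
      + 1 + - + (1 ℕ.+ x ℕ.* n)            ≡⟨ +-congˡ (+ 1) (cong (λ z → - + z) eq) ⟩
      + 1 + - + (y ℕ.* p)                  ≡⟨ +-congˡ (+ 1) (cong -_ (ℤ.pos-* y p)) ⟩
      + 1 + - (+ y * + p)                  ≡⟨ +-congˡ (+ 1) (ℤ.neg-distribˡ-* (+ y) (+ p)) ⟩
      + 1 + - + y * + p                    ∎)
      where
      open ≡-Reasoning
      lem : ∀ n x → n * - x ≡ + 1 + - (+ 1 + x * n)
      lem = solve-∀

  inverse : ∀ a → ¬ a ≈ + 0 → ∃ λ b → a * b ≈ + 1
  inverse (+ n)        a≉0 = ℕ-inverse n a≉0
  inverse a@(ℤ.-[1+ n ]) a≉0 with ℕ-inverse (suc n) (a≉0 ∘ -‿cong)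
  ... | b , e = - b , ≈-trans (≡⇒≈ (lem (+ suc n) b)) e
    where
    lem : ∀ a b → - a * - b ≡ a * b
    lem = solve-∀

  *-cancelˡ-0 : ∀ {a b} → ¬ a ≈ + 0 → a * b ≈ + 0 → b ≈ + 0
  *-cancelˡ-0 {a} {b} a≉0 ab≈0 with inverse a a≉0
  ... | c , ac≈1 = begin
    b               ≡⟨ ℤ.*-identityˡ b ⟨
    + 1 * b         ≈⟨ *-cong ac≈1 (≈-refl {b}) ⟨
    (a * c) * b     ≡⟨ lem a b c ⟩
    c * (a * b)     ≈⟨ *-zeroʳ c ab≈0 ⟩
    + 0             ∎
    where
    open ≈-Reasoning
    lem : ∀ a b c → (a * c) * b ≡ c * (a * b)
    lem = solve-∀

  -- Products with polynomials modulo p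

  -- Modulo p, f is a polynomial of degree below N. Polynomials occur only in this form; N = 0 means
  -- that f is zero modulo p.
  Vanishes : ℕ → Series → Set
  Vanishes N f = ∀ n → N ≤ n → f n ≈ + 0

  tl-vanishes : ∀ {N f} → Vanishes (suc N) f → Vanishes N (tl f)
  tl-vanishes v n N≤n = v (suc n) (s≤s N≤n)

  -- The right factors are compared only up to n, since later a series is known only on an initial
  -- segment.
  ⊛-congₘ : ∀ {f f' g g'} n → (∀ i → f i ≈ f' i) → (∀ i → i ≤ n → g i ≈ g' i) → (f ⊛ g) n ≈ (f' ⊛ g') n
  ⊛-congₘ zero    e h = *-cong (e 0) (h 0 z≤n)
  ⊛-congₘ (suc n) e h =
    +-cong (*-cong (e 0) (h (suc n) ℕ.≤-refl)) (⊛-congₘ n (e ∘ suc) (λ i i≤n → h i (ℕ.m≤n⇒m≤1+n i≤n)))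

  ⊛-zeroˡ : ∀ {f} g n → Vanishes 0 f → (f ⊛ g) n ≈ + 0
  ⊛-zeroˡ g n v = ≈-trans (⊛-congₘ {g = g} {g' = g} n (λ i → v i z≤n) (λ _ _ → ≈-refl))
                          (≡⇒≈ (𝟎-⊛ (λ _ → + 0) g (λ _ → refl) n))

  ⊛-window : ∀ L {f} g m → Vanishes L f → L ≤ suc m →
    (f ⊛ g) m ≈ sumFin (λ (i : Fin L) → f (toℕ i) * g (m ∸ toℕ i))
  ⊛-window zero    g m v _ = ⊛-zeroˡ g m v
  ⊛-window (suc zero) {f} g zero v _ = ≡⇒≈ (sym (ℤ.+-identityʳ (f 0 * g 0)))
  ⊛-window (suc (suc L)) g zero v (s≤s ())
  ⊛-window (suc L) {f} g (suc m) v (s≤s L≤) =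
    +-cong (≈-refl {f 0 * g (suc m)}) (⊛-window L g m (tl-vanishes {f = f} v) L≤)

  ⊛-top : ∀ k n {f g} → Vanishes (suc k) f → Vanishes (suc n) g → (f ⊛ g) (k ℕ.+ n) ≈ f k * g n
  ⊛-top zero    zero    vf vg = ≈-refl
  ⊛-top zero    (suc n) {f} {g} vf vg =
    ≈-trans (+-cong (≈-refl {f 0 * g (suc n)}) (⊛-zeroˡ g n (tl-vanishes {f = f} vf))) (≡⇒≈ (ℤ.+-identityʳ (f 0 * g (suc n))))
  ⊛-top (suc k) n {f} {g} vf vg =
    ≈-trans (+-cong (*-zeroʳ (f 0) (vg (suc (k ℕ.+ n)) (s≤s (ℕ.m≤n+m n k))))
                    (⊛-top k n (tl-vanishes {f = f} vf) vg))
            (≡⇒≈ (ℤ.+-identityˡ (f (suc k) * g n)))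

  ⊛-const : ∀ {f} g n → Vanishes 1 f → (f ⊛ g) n ≈ f 0 * g n
  ⊛-const {f} g zero    v = ≈-refl
  ⊛-const {f} g (suc n) v =
    ≈-trans (+-cong (≈-refl {f 0 * g (suc n)}) (⊛-zeroˡ g n (tl-vanishes {f = f} v)))
            (≡⇒≈ (ℤ.+-identityʳ (f 0 * g (suc n))))

  -- the hypothesis on m puts the whole window of g inside ℕ, so that the shift is not cut off
  ⊛-Δ : ∀ k {f} g c m → Vanishes (suc k) f → k ≤ m → (f ⊛ Δ c g) m ≈ Δ c (f ⊛ g) m
  ⊛-Δ zero    {f} g c m       v k≤m = begin
    (f ⊛ Δ c g) m                       ≈⟨ ⊛-const (Δ c g) m v ⟩
    f 0 * (g (m ℕ.+ c) ℤ.- g m)         ≡⟨ lem (f 0) (g (m ℕ.+ c)) (g m) ⟩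
    f 0 * g (m ℕ.+ c) ℤ.- f 0 * g m     ≈⟨ +-cong (⊛-const g (m ℕ.+ c) v) (-‿cong (⊛-const g m v)) ⟨
    Δ c (f ⊛ g) m                       ∎
    where
    open ≈-Reasoning
    lem : ∀ a b c → a * (b ℤ.- c) ≡ a * b ℤ.- a * c
    lem = solve-∀
  ⊛-Δ (suc k) {f} g c (suc m) v (s≤s k≤m) = begin
    f 0 * (x ℤ.- y) + (tl f ⊛ Δ c g) m    ≈⟨ +-cong (≈-refl {f 0 * (x ℤ.- y)}) (⊛-Δ k g c m (tl-vanishes {f = f} v) k≤m) ⟩
    f 0 * (x ℤ.- y) + (u ℤ.- w)           ≡⟨ lem (f 0) x y u w ⟩
    Δ c (f ⊛ g) (suc m)                   ∎
    where
    open ≈-Reasoning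
    x = g (suc m ℕ.+ c)
    y = g (suc m)
    u = (tl f ⊛ g) (m ℕ.+ c)
    w = (tl f ⊛ g) m
    lem : ∀ a x y u w → a * (x ℤ.- y) + (u ℤ.- w) ≡ (a * x + u) ℤ.- (a * y + w)
    lem = solve-∀

  -- Determinants and kernels modulo p

  IsZero : Vector n → Set
  IsZero v = ∀ c → v c ≈ + 0

  act-zero : ∀ (o : Op n) {v} → IsZero v → IsZero (act o v)
  act-zero o {v} z = act-by (λ x _ → x ≈ + 0) o v v
    (+-zero (z (target o)) (*-zeroʳ (coeff o) (z (source o)))) (λ c _ → z c)

  actAllᵀ-zero⁻¹ : ∀ (os : List (Op n)) v → IsZero (actAllᵀ os v) → IsZero v
  actAllᵀ-zero⁻¹ []       v z = z
  actAllᵀ-zero⁻¹ (o ∷ os) v z = actAllᵀ-zero⁻¹ os v (λ c →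
    subst (_≈ + 0) (act-neg (transpose o) (actAllᵀ os v) c) (act-zero (neg (transpose o)) z c))

  -- The multipliers of an `up` followed by a `down` that clear b. If a is a unit, -b/a does it
  -- alone; if a ≈ 0, b is copied onto the place of a and then subtracted. No column swap occurs, so
  -- the determinant keeps its sign.
  eliminate₂ : ∀ a b → ∃₂ λ x y → b + y * (a + x * b) ≈ + 0
  eliminate₂ a b with a ≈? + 0
  ... | yes a≈0 = + 1 , - + 1 , ≈-trans (≡⇒≈ (lem a b)) (-‿cong a≈0)
    where
    lem : ∀ a b → b + - + 1 * (a + + 1 * b) ≡ - a
    lem = solve-∀
  ... | no a≉0 with inverse a a≉0
  ...   | c , ac≈1 = + 0 , - (b * c) , (begin
      b + - (b * c) * (a + + 0 * b)    ≡⟨ lem₁ a b c ⟩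
      b + - b * (a * c)                ≈⟨ +-cong (≈-refl {b}) (*-cong (≈-refl { - b}) ac≈1) ⟩
      b + - b * + 1                    ≡⟨ lem₂ b ⟩
      + 0                              ∎)
    where
    open ≈-Reasoning
    lem₁ : ∀ a b c → b + - (b * c) * (a + + 0 * b) ≡ b + - b * (a * c)
    lem₁ = solve-∀
    lem₂ : ∀ b → b + - b * + 1 ≡ + 0
    lem₂ = solve-∀

  -- Induction clears the tail except for its own head, by lifted operations that leave entry 0
  -- alone; `eliminate₂` then absorbs this head into entry 0.
  eliminate : (v : Vector (suc n)) → ∃ λ os → IsZero (actAll os v ∘ Fin.suc)
  eliminate {zero}  v = [] , λ ()
  eliminate {suc n} v with eliminate (v ∘ Fin.suc)
  ... | os , z = map lift os ++ os′ , λ c → subst (λ u → u (Fin.suc c) ≈ + 0)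
                   (sym (actAll-++ (map lift os) os′ v)) (cleared c)
    where
    w = actAll (map lift os) v
    x,y = eliminate₂ (w Fin.zero) (w (Fin.suc Fin.zero))
    os′ = up Fin.zero (proj₁ x,y) ∷ down Fin.zero (proj₁ (proj₂ x,y)) ∷ []
    cleared : IsZero (actAll os′ w ∘ Fin.suc)
    cleared Fin.zero    = proj₂ (proj₂ x,y)
    cleared (Fin.suc c) = subst (_≈ + 0) (sym (actAll-lift os v (Fin.suc c))) (z c)

  Kernel : Matrix m n → Set
  Kernel M = ∃ λ v → ¬ IsZero v × ∀ r → dot (M r) v ≈ + 0

  dot-zeroˡ : ∀ {u : Vector n} v → IsZero u → dot u v ≈ + 0
  dot-zeroˡ v z = sumFin≈0 (λ i → *-zeroˡ (v i) (z i))

  -- A kernel vector of the lower right block is padded with 0: the only surviving entry of row 0,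
  -- and the first column, then contribute nothing.
  kernel-extend : ∀ (M : Matrix (suc m) (suc n)) os → IsZero (actAll os (M Fin.zero) ∘ Fin.suc) →
    Kernel (λ r c → actAll os (M (Fin.suc r)) (Fin.suc c)) → Kernel M
  kernel-extend M os z (v , v≉0 , Mv≈0) =
      actAllᵀ os (zeroCons v)
    , (λ e → v≉0 (actAllᵀ-zero⁻¹ os (zeroCons v) e ∘ Fin.suc))
    , λ r → subst (_≈ + 0) (trans (sym (dot-zeroCons (actAll os (M r)) v)) (dot-actAll os (M r) (zeroCons v))) (rows r)
    where
    rows : ∀ r → dot (actAll os (M r) ∘ Fin.suc) v ≈ + 0
    rows Fin.zero    = dot-zeroˡ v z
    rows (Fin.suc r) = Mv≈0 r

  underdetermined-kernel : (M : Matrix n (suc n)) → Kernel M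
  underdetermined-kernel {zero}  M = (λ _ → + 1) , (λ z → 1≉0 (z Fin.zero)) , λ ()
  underdetermined-kernel {suc n} M with eliminate (M Fin.zero)
  ... | os , z = kernel-extend M os z
    (underdetermined-kernel (λ r c → actAll os (M (Fin.suc r)) (Fin.suc c)))

  det-eliminated : ∀ (M : Matrix (suc n) (suc n)) → IsZero (M Fin.zero ∘ Fin.suc) →
    det (suc n) M ≈ M Fin.zero Fin.zero * det n (minor M Fin.zero)
  det-eliminated {n} M z = begin
    + 1 * (a * d) + sumFin (laplaceTerm M ∘ Fin.suc)
      ≈⟨ +-cong (≈-refl {+ 1 * (a * d)}) (sumFin≈0 (λ i → *-zeroʳ (signPow (toℕ (Fin.suc i))) (*-zeroˡ (det n (minor M (Fin.suc i))) (z i)))) ⟩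
    + 1 * (a * d) + + 0 ≡⟨ lem a d ⟩
    a * d ∎
    where
    open ≈-Reasoning
    a = M Fin.zero Fin.zero
    d = det n (minor M Fin.zero)
    lem : ∀ a d → + 1 * (a * d) + + 0 ≡ a * d
    lem = solve-∀

  det≈0⇒kernel : (M : Matrix n n) → det n M ≈ + 0 → Kernel M
  det≈0⇒kernel {zero}  M d≈0 = contradiction d≈0 1≉0
  det≈0⇒kernel {suc n} M d≈0 with eliminate (M Fin.zero)
  ... | os , z with actAll os (M Fin.zero) Fin.zero ≈? + 0
  -- With a zero pivot all of row 0 vanishes, and the remaining rows have one unknown more than
  -- equations.
  ...   | yes a≈0 = let v , v≉0 , Mv≈0 = underdetermined-kernel (λ r → actAll os (M (Fin.suc r))) in
            actAllᵀ os v , (λ e → v≉0 (actAllᵀ-zero⁻¹ os v e))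
          , λ { Fin.zero → subst (_≈ + 0) (dot-actAll os (M Fin.zero) v) (dot-zeroˡ {u = actAll os (M Fin.zero)} v (λ { Fin.zero → a≈0 ; (Fin.suc c) → z c }))
              ; (Fin.suc r) → subst (_≈ + 0) (dot-actAll os (M (Fin.suc r)) v) (Mv≈0 r) }
  ...   | no a≉0 = kernel-extend M os z (det≈0⇒kernel _ (*-cancelˡ-0 a≉0
            (≈-trans (≈-sym (det-eliminated (λ r → actAll os (M r)) z)) (≈-trans (≡⇒≈ (det-actAll os M)) d≈0))))

  -- After elimination the determinant is pivot times minor, so both are units. In the new variables
  -- row 0 forces `w` to vanish at 0, and the other rows then restrict to the minor.
  det≉0⇒kernel-trivial : (M : Matrix n n) → ¬ det n M ≈ + 0 → ∀ v → (∀ r → dot (M r) v ≈ + 0) → IsZero v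
  det≉0⇒kernel-trivial {zero}  M d≉0 v Mv≈0 ()
  det≉0⇒kernel-trivial {suc n} M d≉0 v Mv≈0 with eliminate (M Fin.zero)
  ... | os , z with actAllᵀ-surjective os v
  ...   | w , w↦v = λ c → subst (_≈ + 0) (w↦v c) (zero-actAllᵀ os w≈0 c)
    where
    M′ : Matrix (suc n) (suc n)
    M′ r = actAll os (M r)
    a = M′ Fin.zero Fin.zero
    ad≉0 : ¬ a * det n (minor M′ Fin.zero) ≈ + 0
    ad≉0 e = d≉0 (≈-trans (≡⇒≈ (sym (det-actAll os M))) (≈-trans (det-eliminated M′ z) e))
    M′w≈0 : ∀ r → dot (M′ r) w ≈ + 0
    M′w≈0 r = ≈-trans (≡⇒≈ (trans (dot-actAll os (M r) w) (dot-congʳ (M r) w↦v))) (Mv≈0 r)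
    zero-actAllᵀ : ∀ (os : List (Op n)) {v} → IsZero v → IsZero (actAllᵀ os v)
    zero-actAllᵀ []       z = z
    zero-actAllᵀ (o ∷ os) z = act-zero (transpose o) (zero-actAllᵀ os z)
    w₀≈0 : w Fin.zero ≈ + 0
    w₀≈0 = *-cancelˡ-0 {a} (λ e → ad≉0 (*-zeroˡ (det n (minor M′ Fin.zero)) e))
      (≈-trans (≡⇒≈ (sym (ℤ.+-identityʳ (a * w Fin.zero))))
        (≈-trans (+-cong (≈-refl {a * w Fin.zero}) (≈-sym (dot-zeroˡ {u = M′ Fin.zero ∘ Fin.suc} (w ∘ Fin.suc) z))) (M′w≈0 Fin.zero)))
    w≈0 : IsZero w
    w≈0 Fin.zero    = w₀≈0
    w≈0 (Fin.suc c) = det≉0⇒kernel-trivial (minor M′ Fin.zero)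
      (λ e → ad≉0 (*-zeroʳ a e)) (w ∘ Fin.suc)
      (λ r → ≈-trans (≡⇒≈ (sym (ℤ.+-identityˡ (dot (M′ (Fin.suc r) ∘ Fin.suc) (w ∘ Fin.suc)))))
               (≈-trans (+-cong (≈-sym (*-zeroʳ (M′ (Fin.suc r) Fin.zero) w₀≈0)) ≈-refl) (M′w≈0 (Fin.suc r)))) c

  -- Linear recurrences whose extreme coefficients are units

  ⊛-zeroʳ : ∀ f {g} n → Vanishes 0 g → (f ⊛ g) n ≈ + 0
  ⊛-zeroʳ f {g} n v = ≈-trans (≡⇒≈ (⊛-comm f g n)) (⊛-zeroˡ f n v)

  ⊛-vanishes : ∀ a b {f g} → Vanishes a f → Vanishes (suc b) g → Vanishes (a ℕ.+ b) (f ⊛ g)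
  ⊛-vanishes zero    b {g = g} vf vg n _ = ⊛-zeroˡ g n vf
  ⊛-vanishes (suc a) b {f} vf vg (suc n) (s≤s a+b≤n) =
    +-zero (*-zeroʳ (f 0) (vg (suc n) (s≤s (ℕ.≤-trans (ℕ.m≤n+m b a) a+b≤n))))
           (⊛-vanishes a b (tl-vanishes {f = f} vf) vg n a+b≤n)

  module LinearRecurrence (k : ℕ) (D : Series) (D-zero : D 0 ≈ + 1)
    (D-vanishes : Vanishes (suc k) D) (D-top : ¬ D k ≈ + 0) where

    -- As D 0 is 1 modulo p, each value from a + k on is determined by the k preceding ones, and k
    -- consecutive zeros propagate.
    forward : ∀ a V → Vanishes (a ℕ.+ k) (D ⊛ V) → (∀ i → i < k → V (a ℕ.+ i) ≈ + 0) → Vanishes a V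
    forward a V v z = <-rec (λ n → a ≤ n → V n ≈ + 0) step
      where
      open ≈-Reasoning
      step : ∀ n → (∀ {i} → i < n → a ≤ i → V i ≈ + 0) → a ≤ n → V n ≈ + 0
      step n rec a≤n with a ℕ.+ k ≤? n
      ... | no a+k≰n = subst (λ j → V j ≈ + 0) (ℕ.m+[n∸m]≡n a≤n)
              (z (n ∸ a) (ℕ.+-cancelˡ-< a (n ∸ a) k (subst (_< a ℕ.+ k) (sym (ℕ.m+[n∸m]≡n a≤n)) (ℕ.≰⇒> a+k≰n))))
      step zero rec a≤n | yes a+k≤n = begin
        V 0          ≡⟨ ℤ.*-identityˡ (V 0) ⟨
        + 1 * V 0    ≈⟨ *-cong D-zero (≈-refl {V 0}) ⟨
        (D ⊛ V) 0    ≈⟨ v 0 a+k≤n ⟩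
        + 0          ∎
      step (suc n) rec a≤n | yes a+k≤n = begin
        V (suc n)                               ≡⟨ trans (ℤ.+-identityʳ (+ 1 * V (suc n))) (ℤ.*-identityˡ (V (suc n))) ⟨
        + 1 * V (suc n) + + 0                   ≈⟨ +-cong (*-cong D-zero (≈-refl {V (suc n)})) earlier ⟨
        D 0 * V (suc n) + (tl D ⊛ V) n          ≈⟨ v (suc n) a+k≤n ⟩
        + 0                                     ∎
        where
        earlier : (tl D ⊛ V) n ≈ + 0
        earlier = ≈-trans (⊛-window k V n (tl-vanishes {f = D} D-vanishes) (ℕ.≤-trans (ℕ.m≤n+m k a) a+k≤n))
          (sumFin≈0 (λ i → *-zeroʳ (D (suc (toℕ i))) (rec (s≤s (ℕ.m∸n≤m n (toℕ i)))
            (ℕ.m+n≤o⇒m≤o∸n a (ℕ.≤-pred (ℕ.≤-trans (ℕ.+-monoʳ-< a (Fin.toℕ<n i)) a+k≤n))))))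

    -- Since D k is a unit, the recurrence also determines earlier values from later ones.
    backward : ∀ {V} → Vanishes k (D ⊛ V) → ∀ N → Vanishes N V → Vanishes 0 V
    backward         v zero    z = z
    backward {V = V} v (suc N) z = backward v N z′
      where
      V[N]≈0 : V N ≈ + 0
      V[N]≈0 = *-cancelˡ-0 D-top (≈-trans (≈-sym (⊛-top k N D-vanishes z)) (v (k ℕ.+ N) (ℕ.m≤m+n k N)))
      z′ : Vanishes N V
      z′ n N≤n with N ℕ.≟ n
      ... | yes refl = V[N]≈0
      ... | no N≢n   = z n (ℕ.≤∧≢⇒< N≤n N≢n)

  module Inverse (k′ : ℕ) (D : Series) (D-zero : D 0 ≈ + 1)
    (D-vanishes : Vanishes (suc (suc k′)) D) (D-top : ¬ D (suc k′) ≈ + 0)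
    (F : Series) (D⊛F≐1 : D ⊛ F ≐ const (+ 1)) where

    open LinearRecurrence (suc k′) D D-zero D-vanishes D-top public

    Δ-recurrence : ∀ c {V} → Vanishes (suc k′) (D ⊛ V) → Vanishes (suc k′) (D ⊛ Δ c V)
    Δ-recurrence c {V} v n k≤n = ≈-trans (⊛-Δ (suc k′) V c n D-vanishes k≤n)
      (a≈b⇒a-b≈0 (≈-trans (v (n ℕ.+ c) (ℕ.≤-trans k≤n (ℕ.m≤m+n n c))) (≈-sym (v n k≤n))))

    D⊛F-vanishes : Vanishes (suc k′) (D ⊛ F)
    D⊛F-vanishes n@(suc _) _ = ≡⇒≈ (D⊛F≐1 n)

    F⊛D⊛ : ∀ V → F ⊛ (D ⊛ V) ≐ V
    F⊛D⊛ V n = trans (⊛-swap F D V n) (trans (sym (⊛-assoc D F V n)) (trans (⊛-cong {g = V} D⊛F≐1 (λ _ → refl) n) (1⊛ V n)))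

    D⊛[⊛F] : ∀ P → D ⊛ (P ⊛ F) ≐ P
    D⊛[⊛F] P n = trans (⊛-swap D P F n) (trans (⊛-cong {f = P} (λ _ → refl) D⊛F≐1 n) (⊛-1 P n))

    module _ {c} (periodic : Vanishes 0 (Δ c F)) where

      -- V = (D V) F with D V a polynomial of degree at most K, and past K multiplication by it
      -- commutes with Δ, which kills F.
      eventually-periodic : ∀ K {V} → Vanishes (suc K) (D ⊛ V) → Vanishes K (Δ c V)
      eventually-periodic K {V} v n K≤n = begin
        Δ c V n                  ≡⟨ Δ-cong c (λ i → trans (⊛-comm (D ⊛ V) F i) (F⊛D⊛ V i)) n ⟨
        Δ c ((D ⊛ V) ⊛ F) n      ≈⟨ ⊛-Δ K F c n v K≤n ⟨
        ((D ⊛ V) ⊛ Δ c F) n      ≈⟨ ⊛-zeroʳ (D ⊛ V) n periodic ⟩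
        + 0                      ∎
        where open ≈-Reasoning

      -- D V and θD V being polynomials, V and θV are both eventually c-periodic, so that
      -- c V(n+c) = Δ(θV)(n) - n ΔV(n) vanishes for large n.
      coprime-annihilators : ¬ + c ≈ + 0 → ∀ {V} →
        Vanishes (suc k′) (D ⊛ V) → Vanishes (suc k′) (θ D ⊛ V) → Vanishes 0 V
      coprime-annihilators c≉0 {V} DV θDV = backward DV (k′ ℕ.+ c) late
        where
        open ≈-Reasoning
        -- By the Leibniz rule D θV = θ(D V) - θD V, again of degree below k, so θV satisfies the
        -- same recurrence as V.
        θV : Vanishes (suc k′) (D ⊛ θ V)
        θV n k≤n = begin
          (D ⊛ θ V) n                          ≡⟨ lem ((θ D ⊛ V) n) ((D ⊛ θ V) n) ⟩
          ((θ D ⊛ V) n + (D ⊛ θ V) n) ℤ.- (θ D ⊛ V) n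
            ≡⟨ cong (ℤ._- (θ D ⊛ V) n) (θ-⊛ D V n) ⟨
          + n * (D ⊛ V) n ℤ.- (θ D ⊛ V) n
            ≈⟨ +-cong (*-zeroʳ (+ n) (DV n k≤n)) (-‿cong (θDV n k≤n)) ⟩
          + 0                                  ∎
          where
          lem : ∀ a b → b ≡ (a + b) ℤ.- a
          lem = solve-∀
        late : Vanishes (k′ ℕ.+ c) V
        late m k′+c≤m = subst (λ j → V j ≈ + 0) (ℕ.m∸n+n≡m (ℕ.m+n≤o⇒n≤o k′ k′+c≤m)) (*-cancelˡ-0 c≉0 cV≈0)
          where
          i = m ∸ c
          k′≤i : k′ ≤ i
          k′≤i = ℕ.m+n≤o⇒m≤o∸n k′ k′+c≤m
          cV≈0 : + c * V (i ℕ.+ c) ≈ + 0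
          cV≈0 = begin
            + c * V (i ℕ.+ c)    ≡⟨ ℤ.+-identityˡ (+ c * V (i ℕ.+ c)) ⟨
            + 0 + + c * V (i ℕ.+ c)  ≈⟨ +-cong (*-zeroʳ (+ i) (eventually-periodic k′ DV i k′≤i)) (≈-refl {+ c * V (i ℕ.+ c)}) ⟨
            + i * Δ c V i + + c * V (i ℕ.+ c)  ≡⟨ Δ-θ c V i ⟨
            Δ c (θ V) i          ≈⟨ eventually-periodic k′ θV i k′≤i ⟩
            + 0                  ∎

  -- Frobenius, Fermat and p-th powers of series

  p∣pCk : ∀ {q} → p ≡ suc q → ∀ k → suc k < p → p ∣ p C suc k
  p∣pCk {q} refl k k<p with euclidsLemma (suc k) (p C suc k) p-prime
    (subst (p ∣_) (sym ([k+1]*[n+1]C[k+1]≡[n+1]*nCk q k)) (m∣m*n (q C k)))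
  ... | inj₁ p∣k = contradiction (∣⇒≤ p∣k) (ℕ.<⇒≱ k<p)
  ... | inj₂ p∣C = p∣C

  module Frobenius {a ℓ} (R : CommutativeSemiring a ℓ) where
    open CommutativeSemiring R renaming (Carrier to A; _≈_ to _∼_; _+_ to _⊕_; _*_ to _⊗_; refl to ∼-refl; sym to ∼-sym; trans to ∼-trans; +-cong to ⊕-cong; +-congˡ to ⊕-congˡ)
    open Algebra.Properties.CommutativeSemiring.Binomial R
    open Algebra.Properties.CommutativeSemiring.Exp R using () renaming (_^_ to _↑_)
    open Algebra.Properties.Semiring.Mult semiring using (×-assocˡ; ×-homo-1) renaming (_×_ to _·_)
    open Algebra.Properties.CommutativeMonoid.Mult +-commutativeMonoid using (×-distrib-+)
    open Algebra.Properties.Semiring.Sum semiring using (sum; sum-init-last)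

    sum-multiple : ∀ {n} (f : Fin n → A) → (∀ i → ∃ λ z → f i ∼ p · z) → ∃ λ z → sum f ∼ p · z
    sum-multiple {zero}  f h = 0# , ∼-sym (·0 p)
      where
      ·0 : ∀ n → n · 0# ∼ 0#
      ·0 zero    = ∼-refl
      ·0 (suc n) = ∼-trans (+-identityˡ (n · 0#)) (·0 n)
    sum-multiple {suc n} f h with h Fin.zero | sum-multiple (f ∘ Fin.suc) (h ∘ Fin.suc)
    ... | z , e | z′ , e′ = z ⊕ z′ , ∼-trans (⊕-cong e e′) (∼-sym (×-distrib-+ z z′ p))

    -- The error is an explicit p-fold multiple, which makes sense in any semiring. It is used in ℤ
    -- for Fermat and in the series ring for F^p, and vanishes modulo p in both.
    frobenius : ∀ x y → ∃ λ z → ((x ⊕ y) ↑ p) ∼ ((x ↑ p) ⊕ (y ↑ p)) ⊕ (p · z)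
    frobenius x y = expand p refl
      where
      open import Relation.Binary.Reasoning.Setoid setoid
      -- A variable q equal to p can be matched as a successor, which exposes both outer terms of
      -- the binomial sum.
      expand : ∀ q → q ≡ p → ∃ λ z → ((x ⊕ y) ↑ q) ∼ ((x ↑ q) ⊕ (y ↑ q)) ⊕ (p · z)
      expand zero    0≡p = contradiction (subst Prime (sym 0≡p) p-prime) λ ()
      expand (suc q) q≡p = proj₁ middle , (begin
        (x ⊕ y) ↑ suc q                               ≈⟨ theorem (suc q) x y ⟩
        f Fin.zero ⊕ sum (f ∘ Fin.suc)                ≈⟨ ⊕-congˡ (sum-init-last (f ∘ Fin.suc)) ⟩
        f Fin.zero ⊕ (sum (λ i → f (Fin.suc (inject₁ i))) ⊕ f (Fin.suc (fromℕ q)))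
          ≈⟨ ⊕-cong first (⊕-cong (proj₂ middle) last) ⟩
        y ↑ suc q ⊕ (p · proj₁ middle ⊕ x ↑ suc q)    ≈⟨ +-comm (y ↑ suc q) (p · proj₁ middle ⊕ x ↑ suc q) ⟩
        (p · proj₁ middle ⊕ x ↑ suc q) ⊕ y ↑ suc q    ≈⟨ +-assoc (p · proj₁ middle) (x ↑ suc q) (y ↑ suc q) ⟩
        p · proj₁ middle ⊕ (x ↑ suc q ⊕ y ↑ suc q)    ≈⟨ +-comm (p · proj₁ middle) (x ↑ suc q ⊕ y ↑ suc q) ⟩
        (x ↑ suc q ⊕ y ↑ suc q) ⊕ p · proj₁ middle    ∎)
        where
        f : Fin (suc (suc q)) → A
        f = binomialTerm x y (suc q)
        first : f Fin.zero ∼ y ↑ suc q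
        first = ∼-trans (×-homo-1 (1# ⊗ y ↑ suc q)) (*-identityˡ (y ↑ suc q))
        last : f (Fin.suc (fromℕ q)) ∼ x ↑ suc q
        last = begin
          (suc q C suc (toℕ (fromℕ q))) · (x ↑ suc (toℕ (fromℕ q)) ⊗ y ↑ (q ∸ toℕ (fromℕ q)))
            ≡⟨ cong (λ j → (suc q C suc j) · (x ↑ suc j ⊗ y ↑ (q ∸ j))) (Fin.toℕ-fromℕ q) ⟩
          (suc q C suc q) · (x ↑ suc q ⊗ y ↑ (q ∸ q))
            ≡⟨ cong₂ (λ c j → c · (x ↑ suc q ⊗ y ↑ j)) (nCn≡1 (suc q)) (ℕ.n∸n≡0 q) ⟩
          1 · (x ↑ suc q ⊗ 1#)   ≈⟨ ×-homo-1 (x ↑ suc q ⊗ 1#) ⟩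
          x ↑ suc q ⊗ 1#         ≈⟨ *-identityʳ (x ↑ suc q) ⟩
          x ↑ suc q              ∎
        middle : ∃ λ z → sum (λ i → f (Fin.suc (inject₁ i))) ∼ p · z
        middle = sum-multiple (λ i → f (Fin.suc (inject₁ i))) λ i → multiple i
          (p∣pCk (sym q≡p) (toℕ (inject₁ i)) (subst (suc (toℕ (inject₁ i)) <_) q≡p
            (s≤s (subst (_< q) (sym (Fin.toℕ-inject₁ i)) (Fin.toℕ<n i)))))
          where
          multiple : ∀ i → p ∣ p C suc (toℕ (inject₁ i)) → ∃ λ z → f (Fin.suc (inject₁ i)) ∼ p · z
          multiple i (divides e eq) = e · b , (begin
            (suc q C j) · b   ≡⟨ cong (_· b) (trans (cong (_C j) q≡p) (trans eq (ℕ.*-comm e p))) ⟩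
            (p ℕ.* e) · b     ≈⟨ ×-assocˡ b p e ⟨
            p · (e · b)       ∎)
            where
            j = suc (toℕ (inject₁ i))
            b = binomial x y (suc q) (Fin.suc (inject₁ i))

  module ℤFrobenius = Frobenius (CommutativeRing.commutativeSemiring ℤ.+-*-commutativeRing)
  module SeriesFrobenius = Frobenius (CommutativeRing.commutativeSemiring seriesRing)

  p≈0 : + p ≈ + 0
  p≈0 = congruent (+ 1) (sym (trans (ℤ.+-identityˡ (+ 1 * + p)) (ℤ.*-identityˡ (+ p))))

  frobeniusᶻ : ∀ a b → (a + b) ^ᶻ p ≈ a ^ᶻ p + b ^ᶻ p
  frobeniusᶻ a b with ℤFrobenius.frobenius a b
  ... | z , e = ≈-trans (≡⇒≈ e) (≈-trans (+-cong (≈-refl {a ^ᶻ p + b ^ᶻ p})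
          (≈-trans (≡⇒≈ (×ᶻ≡* p z)) (*-zeroˡ z p≈0))) (≡⇒≈ (ℤ.+-identityʳ (a ^ᶻ p + b ^ᶻ p))))

  frobeniusˢ : ∀ f g n → ((f ⊞ g) ^ p) n ≈ (f ^ p) n + (g ^ p) n
  frobeniusˢ f g n with SeriesFrobenius.frobenius f g
  ... | z , e = ≈-trans (≡⇒≈ (e n)) (≈-trans (+-cong (≈-refl {(f ^ p) n + (g ^ p) n})
          (≈-trans (≡⇒≈ (×ˢ≐∙ p z n)) (*-zeroˡ (z n) p≈0))) (≡⇒≈ (ℤ.+-identityʳ ((f ^ p) n + (g ^ p) n))))

  -- Induction with Frobenius applied to 1 + n; for negative arguments, Frobenius is applied to -n +
  -- n = 0.
  fermat : ∀ a → a ^ᶻ p ≈ a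
  fermat (+ n) = nonneg n
    where
    open ≈-Reasoning
    1^ : ∀ n → (+ 1) ^ᶻ n ≡ + 1
    1^ zero    = refl
    1^ (suc n) = trans (ℤ.*-identityˡ ((+ 1) ^ᶻ n)) (1^ n)
    0^ : ∀ q → q ≡ p → (+ 0) ^ᶻ q ≡ + 0
    0^ zero    e = contradiction (subst Prime (sym e) p-prime) λ ()
    0^ (suc q) e = refl
    nonneg : ∀ n → (+ n) ^ᶻ p ≈ + n
    nonneg zero    = ≡⇒≈ (0^ p refl)
    nonneg (suc n) = ≈-trans (frobeniusᶻ (+ 1) (+ n)) (+-cong (≡⇒≈ (1^ p)) (nonneg n))
  fermat -n@(ℤ.-[1+ n ]) = begin
    -n ^ᶻ p                        ≡⟨ lem (-n ^ᶻ p) ((+ suc n) ^ᶻ p) ⟩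
    (-n ^ᶻ p + (+ suc n) ^ᶻ p) ℤ.- (+ suc n) ^ᶻ p
      ≈⟨ +-cong (frobeniusᶻ -n (+ suc n)) (≈-refl { - ((+ suc n) ^ᶻ p)}) ⟨
    (-n + + suc n) ^ᶻ p ℤ.- (+ suc n) ^ᶻ p
      ≡⟨ cong (λ z → z ^ᶻ p ℤ.- (+ suc n) ^ᶻ p) (ℤ.+-inverseˡ (+ suc n)) ⟩
    (+ 0) ^ᶻ p ℤ.- (+ suc n) ^ᶻ p
      ≈⟨ +-cong (fermat (+ 0)) (-‿cong (fermat (+ suc n))) ⟩
    + 0 ℤ.- + suc n                ≡⟨ ℤ.+-identityˡ -n ⟩
    -n                             ∎
    where
    open ≈-Reasoning
    lem : ∀ a b → a ≡ (a + b) ℤ.- b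
    lem = solve-∀

  -- f(x)^p = f(x^p) modulo p, on the exponents divisible by p
  ^p-multiples : ∀ f n → (f ^ p) (n ℕ.* p) ≈ f n
  ^p-multiples f zero    = ≈-trans (≡⇒≈ (^-zero p)) (fermat (f 0))
    where
    ^-zero : ∀ q → (f ^ q) 0 ≡ f 0 ^ᶻ q
    ^-zero zero    = refl
    ^-zero (suc q) = cong (f 0 *_) (^-zero q)
  ^p-multiples f (suc n) = begin
    (f ^ p) (p ℕ.+ n ℕ.* p)
      -- Splitting f = f 0 + x · tl f gives f^p ≈ (f 0)^p + x^p (tl f)^p; at exponent p + n p only
      -- the second summand is left.
      ≡⟨ ^-congˡ p (const⊞X⊛tl f) (p ℕ.+ n ℕ.* p) ⟩
    ((const (f 0) ⊞ (X ⊛ tl f)) ^ p) (p ℕ.+ n ℕ.* p)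
      ≈⟨ frobeniusˢ (const (f 0)) (X ⊛ tl f) (p ℕ.+ n ℕ.* p) ⟩
    (const (f 0) ^ p) (p ℕ.+ n ℕ.* p) + ((X ⊛ tl f) ^ p) (p ℕ.+ n ℕ.* p)
      ≡⟨ cong₂ _+_ (trans (const-^ (f 0) p (p ℕ.+ n ℕ.* p)) (const-positive p refl))
           (trans (^-distrib-* X (tl f) p (p ℕ.+ n ℕ.* p)) (X^⊛ p (tl f ^ p) (n ℕ.* p))) ⟩
    + 0 + (tl f ^ p) (n ℕ.* p)
      ≡⟨ ℤ.+-identityˡ ((tl f ^ p) (n ℕ.* p)) ⟩
    (tl f ^ p) (n ℕ.* p)
      ≈⟨ ^p-multiples (tl f) n ⟩
    f (suc n) ∎
    where
    open ≈-Reasoning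
    const-positive : ∀ q → q ≡ p → const (f 0 ^ᶻ p) (q ℕ.+ n ℕ.* p) ≡ + 0
    const-positive zero    e = contradiction (subst Prime (sym e) p-prime) λ ()
    const-positive (suc q) e = refl

  -- Sylvester rows as coefficients of products

  -- A band row is x^r times the reversed polynomial, so its product with a window is one
  -- coefficient of a product of series. The bound d + r < L keeps the band inside the row.
  band-row : ∀ d a r {L} g m → d ℕ.+ r < L → L ≤ suc m →
    dot (λ (c : Fin L) → band d a r (toℕ c)) (window L g m) ≈ (rev d a ⊛ g) (m ∸ r)
  band-row d a r {L} g m d+r<L L≤1+m = ≈-trans
    (≈-sym (⊛-window L {shift r (rev d a)} g m
      (λ n L≤n → ≡⇒≈ (shift-> r (rev d a) (λ i → rev-> d a) n (ℕ.≤-trans d+r<L L≤n))) L≤1+m))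
    (≡⇒≈ (shift-⊛ r (rev d a) g (ℕ.≤-trans (ℕ.m≤n+m r d) (ℕ.≤-pred (ℕ.≤-trans d+r<L L≤1+m)))))

  module _ (m : ℕ) (a : Series) (n : ℕ) (b : Series) where

    private
      L = n ℕ.+ m
      S = sylvester m a n b

    sylvester-rowˡ : ∀ r g N → L ≤ suc N → toℕ r < n → dot (S r) (window L g N) ≈ (rev m a ⊛ g) (N ∸ toℕ r)
    sylvester-rowˡ r g N L≤ r<n = ≈-trans
      (≡⇒≈ (sumFin-cong {L} (λ c → cong (λ x → (if x then band m a (toℕ r) (toℕ c) else band n b (toℕ r ∸ n) (toℕ c)) * window L g N c)
        (dec-true (suc (toℕ r) ≤? n) r<n))))
      (band-row m a (toℕ r) g N (subst (_< L) (ℕ.+-comm (toℕ r) m) (ℕ.+-monoˡ-< m r<n)) L≤)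

    sylvester-rowʳ : ∀ r g N → L ≤ suc N → n ≤ toℕ r → dot (S r) (window L g N) ≈ (rev n b ⊛ g) (N ∸ (toℕ r ∸ n))
    sylvester-rowʳ r g N L≤ n≤r = ≈-trans
      (≡⇒≈ (sumFin-cong {L} (λ c → cong (λ x → (if x then band m a (toℕ r) (toℕ c) else band n b (toℕ r ∸ n) (toℕ c)) * window L g N c)
        (dec-false (suc (toℕ r) ≤? n) (ℕ.≤⇒≯ n≤r)))))
      (band-row n b (toℕ r ∸ n) g N (subst (_< L) (sym (ℕ.m+[n∸m]≡n n≤r)) (Fin.toℕ<n r)) L≤)

    -- Every window of V that lies far enough out is in the kernel of the nonsingular Sylvester
    -- matrix, and entry 0 of the window at j is V j. Adding L to N leaves room for the shifts of
    -- all rows.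
    common-annihilator : ¬ resultant m a n b ≈ + 0 → 0 < L → ∀ N V →
      Vanishes N (rev m a ⊛ V) → Vanishes N (rev n b ⊛ V) → Vanishes (N ℕ.+ L) V
    common-annihilator res≉0 0<L N V aV bV j N+L≤j =
      subst (λ i → V (j ∸ i) ≈ + 0) (Fin.toℕ-fromℕ< 0<L)
        (det≉0⇒kernel-trivial S res≉0 (window L V j) rows (fromℕ< 0<L))
      where
      L≤1+j : L ≤ suc j
      L≤1+j = ℕ.m≤n⇒m≤1+n (ℕ.≤-trans (ℕ.m≤n+m L N) N+L≤j)
      late : ∀ i → i ≤ L → N ≤ j ∸ i
      late i i≤L = ℕ.m+n≤o⇒m≤o∸n N (ℕ.≤-trans (ℕ.+-monoʳ-≤ N i≤L) N+L≤j)
      rows : ∀ r → dot (S r) (window L V j) ≈ + 0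
      rows r with suc (toℕ r) ≤? n
      ... | yes r<n = ≈-trans (sylvester-rowˡ r V j L≤1+j r<n) (aV (j ∸ toℕ r) (late (toℕ r) (ℕ.<⇒≤ (Fin.toℕ<n r))))
      ... | no r≮n  = ≈-trans (sylvester-rowʳ r V j L≤1+j (ℕ.≮⇒≥ r≮n))
              (bV (j ∸ (toℕ r ∸ n)) (late (toℕ r ∸ n) (ℕ.≤-trans (ℕ.m∸n≤m (toℕ r) n) (ℕ.<⇒≤ (Fin.toℕ<n r)))))

  -- The resultant of C and C′ against the periods of F

  module Discriminant (k′ : ℕ) (t : Fin (suc k′) → ℤ) (t-last≉0 : ¬ tLast (suc k′) t ≈ + 0) where

    open Recurrence k′ t

    D-vanishes : Vanishes (suc k) D
    D-vanishes n k<n = ≡⇒≈ (D-> n k<n)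

    D-top≉0 : ¬ D k ≈ + 0
    D-top≉0 e = t-last≉0 (≈-trans (≡⇒≈ (trans (sym (ℤ.neg-involutive (tLast k t))) (cong -_ (sym D-top)))) (-‿cong e))

    Fₖ : Series
    Fₖ = F k t

    open Inverse k′ D (≡⇒≈ D-zero) D-vanishes D-top≉0 Fₖ D⊛F≐1

    E⊛≐ : ∀ V → E ⊛ V ≐ (+ k ∙ (D ⊛ V)) ⊞ ((- + 1) ∙ (θ D ⊛ V))
    E⊛≐ V n = begin
      (E ⊛ V) n                                                   ≡⟨ ⊛-cong {g = V} E≐kD-θD (λ _ → refl) n ⟩
      (((+ k ∙ D) ⊞ ((- + 1) ∙ θ D)) ⊛ V) n                       ≡⟨ ⊛-distribʳ V (+ k ∙ D) ((- + 1) ∙ θ D) n ⟩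
      ((+ k ∙ D) ⊛ V) n + (((- + 1) ∙ θ D) ⊛ V) n                 ≡⟨ cong₂ _+_ (∙-⊛ (+ k) D V n) (∙-⊛ (- + 1) (θ D) V n) ⟩
      + k * (D ⊛ V) n + - + 1 * (θ D ⊛ V) n                       ∎
      where open ≡-Reasoning

    Res : ℤ
    Res = resultant k (coeffC k t) k′ (coeffC' k t)

    L : ℕ
    L = k′ ℕ.+ k

    0<L : 0 < L
    0<L = ℕ.≤-trans (s≤s z≤n) (ℕ.m≤n+m k k′)

    EventuallyPeriodic : ℕ → Series → Set
    EventuallyPeriodic c V = ∃ λ N → Vanishes N (Δ c V)

    module _ {c} (c≈0 : + c ≈ + 0) (Res≉0 : ¬ Res ≈ + 0) where

      -- With G = F^(j+1) and Z = F G one has D Z = G and θG = -(j+1) θD Z, so D and θD, hence E,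
      -- send ΔZ to a polynomial. In the bound, k pays for moving Δ past D and E, and L for the
      -- Sylvester window.
      periodic-step : ∀ j → ¬ + suc j ≈ + 0 →
        EventuallyPeriodic c (Fₖ ^ suc j) → EventuallyPeriodic c (Fₖ ^ suc (suc j))
      periodic-step j j≉0 (N , ΔG≈0) = N ℕ.+ k ℕ.+ L ,
        common-annihilator k (coeffC k t) k′ (coeffC' k t) Res≉0 0<L (N ℕ.+ k) (Δ c Z) DΔZ EΔZ
        where
        open ≈-Reasoning
        G Z : Series
        G = Fₖ ^ suc j
        Z = Fₖ ⊛ G
        θDZ≈0 : ∀ n → N ≤ n → Δ c (θ D ⊛ Z) n ≈ + 0
        θDZ≈0 n N≤n = *-cancelˡ-0 j≉0 (begin
          + suc j * (x ℤ.- y)                          ≡⟨ lem (+ suc j) x y ⟩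
          - (- + suc j * x ℤ.- - + suc j * y)          ≡⟨ cong -_ (Δ-cong c (θ-^ D⊛F≐1 (suc j)) n) ⟨
          - Δ c (θ G) n                                ≡⟨ cong -_ (Δ-θ c G n) ⟩
          - (+ n * Δ c G n + + c * G (n ℕ.+ c))        ≈⟨ -‿cong (+-zero (*-zeroʳ (+ n) (ΔG≈0 n N≤n)) (*-zeroˡ (G (n ℕ.+ c)) c≈0)) ⟩
          + 0                                          ∎)
          where
          x = (θ D ⊛ Z) (n ℕ.+ c)
          y = (θ D ⊛ Z) n
          lem : ∀ a x y → a * (x ℤ.- y) ≡ - (- a * x ℤ.- - a * y)
          lem = solve-∀
        DΔZ : Vanishes (N ℕ.+ k) (D ⊛ Δ c Z)
        DΔZ n N+k≤n = begin
          (D ⊛ Δ c Z) n     ≈⟨ ⊛-Δ k Z c n D-vanishes (ℕ.m+n≤o⇒n≤o N N+k≤n) ⟩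
          Δ c (D ⊛ Z) n     ≡⟨ Δ-cong c (D⊛[F⊛] D⊛F≐1 G) n ⟩
          Δ c G n           ≈⟨ ΔG≈0 n (ℕ.m+n≤o⇒m≤o N N+k≤n) ⟩
          + 0               ∎
        EΔZ : Vanishes (N ℕ.+ k) (E ⊛ Δ c Z)
        EΔZ n N+k≤n = begin
          (E ⊛ Δ c Z) n
            ≈⟨ ⊛-Δ k′ Z c n (λ i k≤i → ≡⇒≈ (E-> i k≤i)) (ℕ.≤-trans (ℕ.n≤1+n k′) (ℕ.m+n≤o⇒n≤o N N+k≤n)) ⟩
          Δ c (E ⊛ Z) n
            ≡⟨ Δ-cong c (E⊛≐ Z) n ⟩
          (+ k * u + - + 1 * x) ℤ.- (+ k * w + - + 1 * y)
            ≡⟨ lem (+ k) u w x y ⟩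
          + k * Δ c (D ⊛ Z) n + - + 1 * Δ c (θ D ⊛ Z) n
            ≡⟨ cong (λ z → + k * z + - + 1 * Δ c (θ D ⊛ Z) n) (Δ-cong c (D⊛[F⊛] D⊛F≐1 G) n) ⟩
          + k * Δ c G n + - + 1 * Δ c (θ D ⊛ Z) n
            ≈⟨ +-zero (*-zeroʳ (+ k) (ΔG≈0 n (ℕ.m+n≤o⇒m≤o N N+k≤n))) (*-zeroʳ (- + 1) (θDZ≈0 n (ℕ.m+n≤o⇒m≤o N N+k≤n))) ⟩
          + 0 ∎
          where
          u = (D ⊛ Z) (n ℕ.+ c)
          w = (D ⊛ Z) n
          x = (θ D ⊛ Z) (n ℕ.+ c)
          y = (θ D ⊛ Z) n
          lem : ∀ k u w x y → (k * u + - + 1 * x) ℤ.- (k * w + - + 1 * y) ≡ k * (u ℤ.- w) + - + 1 * (x ℤ.- y)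
          lem = solve-∀

      periodic-^ : Vanishes 0 (Δ c Fₖ) → ∀ j → suc j ≤ p → EventuallyPeriodic c (Fₖ ^ suc j)
      periodic-^ ΔF≈0 zero    _   = 0 , λ n z≤n → ≈-trans (≡⇒≈ (Δ-cong c (⊛-1 Fₖ) n)) (ΔF≈0 n z≤n)
      -- The step divides by j + 1, still below p here; the next division after reaching F^p would
      -- be by p.
      periodic-^ ΔF≈0 (suc j) j<p = periodic-step j (λ e → ℕ.<⇒≱ j<p (∣⇒≤ (≈0⇒∣ e))) (periodic-^ ΔF≈0 j (ℕ.<⇒≤ j<p))

    -- F^p at n p is F n, so a shift of F^p by q p is a shift of F by q. This holds only eventually,
    -- and `backward` carries it down to index 0.
    period/p : ∀ q → Vanishes 0 (Δ (q ℕ.* p) Fₖ) → ¬ Res ≈ + 0 → Vanishes 0 (Δ q Fₖ)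
    period/p q ΔF≈0 Res≉0 = backward (Δ-recurrence q D⊛F-vanishes) N ΔqF≈0
      where
      open ≈-Reasoning
      p-positive : ∀ i → i ≡ p → EventuallyPeriodic (q ℕ.* p) (Fₖ ^ i)
      p-positive zero    e = contradiction (subst Prime (sym e) p-prime) λ ()
      p-positive (suc i) e = periodic-^ (≈-trans (≡⇒≈ (ℤ.pos-* q p)) (*-zeroʳ (+ q) p≈0)) Res≉0 ΔF≈0 i (ℕ.≤-reflexive e)
      N = proj₁ (p-positive p refl)
      1≤p : 1 ≤ p
      1≤p = ℕ.n≢0⇒n>0 λ e → contradiction (subst Prime e p-prime) λ ()
      ΔqF≈0 : Vanishes N (Δ q Fₖ)
      ΔqF≈0 n N≤n = begin
        Fₖ (n ℕ.+ q) ℤ.- Fₖ n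
          ≈⟨ +-cong (^p-multiples Fₖ (n ℕ.+ q)) (-‿cong (^p-multiples Fₖ n)) ⟨
        (Fₖ ^ p) ((n ℕ.+ q) ℕ.* p) ℤ.- (Fₖ ^ p) (n ℕ.* p)
          ≡⟨ cong (λ i → (Fₖ ^ p) i ℤ.- (Fₖ ^ p) (n ℕ.* p)) (ℕ.*-distribʳ-+ p n q) ⟩
        Δ (q ℕ.* p) (Fₖ ^ p) (n ℕ.* p)
          ≈⟨ proj₂ (p-positive p refl) (n ℕ.* p) (ℕ.≤-trans N≤n (ℕ.≤-trans (ℕ.≤-reflexive (sym (ℕ.*-identityʳ n))) (ℕ.*-monoʳ-≤ n 1≤p))) ⟩
        + 0 ∎

    -- A kernel vector v is continued to a series W for which D W and θD W both have degree below k.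
    -- Such a W vanishes by `coprime-annihilators`, and v is a window of it.
    Res≉0 : ∀ {c} → Vanishes 0 (Δ c Fₖ) → ¬ + c ≈ + 0 → ¬ Res ≈ + 0
    Res≉0 {c} ΔF≈0 c≉0 Res≈0 with det≈0⇒kernel (sylvester k (coeffC k t) k′ (coeffC' k t)) Res≈0
    ... | v , v≉0 , Sv≈0 = v≉0 v≈0
      where
      open ≈-Reasoning
      S = sylvester k (coeffC k t) k′ (coeffC' k t)
      N = k′ ℕ.+ k′
      L≡1+N : L ≡ suc N
      L≡1+N = ℕ.+-suc k′ k′
      L≤1+N : L ≤ suc N
      L≤1+N = ℕ.≤-reflexive L≡1+N
      -- v read as the window ending at N of a series g
      g P W : Series
      g j = extend v (N ∸ j)
      -- Past N truncated subtraction makes g constant, which is junk. Cutting D g at degree k and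
      -- multiplying by F keeps the window and continues it by the recurrence.
      P = truncate k (D ⊛ g)
      W = P ⊛ Fₖ
      i≤N : ∀ (i : Fin L) → toℕ i ≤ N
      i≤N i = ℕ.≤-pred (subst (toℕ i <_) L≡1+N (Fin.toℕ<n i))
      g-window : ∀ i → window L g N i ≡ v i
      g-window i = trans (cong (extend v) (ℕ.m∸[m∸n]≡n (i≤N i))) (extend-toℕ v i)
      rows : ∀ r → dot (S r) (window L g N) ≈ + 0
      rows r = ≈-trans (≡⇒≈ (dot-congʳ (S r) g-window)) (Sv≈0 r)
      D⊛g≈0 : ∀ n → k ≤ n → n ≤ N → (D ⊛ g) n ≈ + 0
      D⊛g≈0 n k≤n n≤N = begin
        (D ⊛ g) n                 ≡⟨ cong (D ⊛ g) (trans (cong (N ∸_) r≡) (ℕ.m∸[m∸n]≡n n≤N)) ⟨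
        (D ⊛ g) (N ∸ toℕ r)       ≈⟨ sylvester-rowˡ k (coeffC k t) k′ (coeffC' k t) r g N L≤1+N (subst (_< k′) (sym r≡) r<k′) ⟨
        dot (S r) (window L g N)  ≈⟨ rows r ⟩
        + 0                       ∎
        where
        r<k′ : N ∸ n < k′
        r<k′ = ℕ.+-cancelʳ-< n (N ∸ n) k′ (subst (_< k′ ℕ.+ n) (sym (ℕ.m∸n+n≡m n≤N)) (ℕ.+-monoʳ-< k′ k≤n))
        r : Fin L
        r = fromℕ< (ℕ.<-≤-trans r<k′ (ℕ.m≤m+n k′ k))
        r≡ : toℕ r ≡ N ∸ n
        r≡ = Fin.toℕ-fromℕ< (ℕ.<-≤-trans r<k′ (ℕ.m≤m+n k′ k))
      E⊛g≈0 : ∀ n → k′ ≤ n → n ≤ N → (E ⊛ g) n ≈ + 0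
      E⊛g≈0 n k′≤n n≤N = begin
        (E ⊛ g) n                        ≡⟨ cong (E ⊛ g) (trans (cong (N ∸_) r∸k′≡) (ℕ.m∸[m∸n]≡n n≤N)) ⟨
        (E ⊛ g) (N ∸ (toℕ r ∸ k′))       ≈⟨ sylvester-rowʳ k (coeffC k t) k′ (coeffC' k t) r g N L≤1+N (subst (k′ ≤_) (sym r≡) (ℕ.m≤m+n k′ (N ∸ n))) ⟨
        dot (S r) (window L g N)         ≈⟨ rows r ⟩
        + 0                              ∎
        where
        s<k : N ∸ n < k
        s<k = s≤s (ℕ.≤-trans (ℕ.∸-monoʳ-≤ N k′≤n) (ℕ.≤-reflexive (ℕ.m+n∸n≡m k′ k′)))
        r : Fin L
        r = fromℕ< (ℕ.+-monoʳ-< k′ s<k)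
        r≡ : toℕ r ≡ k′ ℕ.+ (N ∸ n)
        r≡ = Fin.toℕ-fromℕ< (ℕ.+-monoʳ-< k′ s<k)
        r∸k′≡ : toℕ r ∸ k′ ≡ N ∸ n
        r∸k′≡ = trans (cong (_∸ k′) r≡) (ℕ.m+n∸m≡n k′ (N ∸ n))
      P≈D⊛g : ∀ n → n ≤ N → P n ≈ (D ⊛ g) n
      P≈D⊛g n n≤N with suc n ≤? k
      ... | yes n<k = ≡⇒≈ (truncate-< k (D ⊛ g) n<k)
      ... | no n≮k  = ≈-trans (≡⇒≈ (truncate-≥ k (D ⊛ g) (ℕ.≮⇒≥ n≮k))) (≈-sym (D⊛g≈0 n (ℕ.≮⇒≥ n≮k) n≤N))
      P-vanishes : Vanishes k P
      P-vanishes n k≤n = ≡⇒≈ (truncate-≥ k (D ⊛ g) k≤n)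
      W≈g : ∀ n → n ≤ N → W n ≈ g n
      W≈g n n≤N = begin
        (P ⊛ Fₖ) n          ≡⟨ ⊛-comm P Fₖ n ⟩
        (Fₖ ⊛ P) n          ≈⟨ ⊛-congₘ {f = Fₖ} {f' = Fₖ} n (λ _ → ≈-refl) (λ i i≤n → P≈D⊛g i (ℕ.≤-trans i≤n n≤N)) ⟩
        (Fₖ ⊛ (D ⊛ g)) n    ≡⟨ F⊛D⊛ g n ⟩
        g n                 ∎
      DW : Vanishes k (D ⊛ W)
      DW n k≤n = ≈-trans (≡⇒≈ (D⊛[⊛F] P n)) (P-vanishes n k≤n)
      EW : Vanishes k′ (E ⊛ W)
      -- D E W = E P has degree at most 2k′, so E W obeys the recurrence from k′ + k on. The second
      -- block of k rows supplies its k starting zeros, at k′, ..., 2k′.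
      EW = forward k′ (E ⊛ W)
        (λ n L≤n → ≈-trans (≡⇒≈ (trans (⊛-swap D E W n) (⊛-cong {f = E} (λ _ → refl) (D⊛[⊛F] P) n)))
          (⊛-vanishes k k′ (λ i k≤i → ≡⇒≈ (E-> i k≤i)) P-vanishes n (subst (_≤ n) (ℕ.+-comm k′ k) L≤n)))
        (λ i i<k → let n≤N = ℕ.+-monoʳ-≤ k′ (ℕ.≤-pred i<k) in
          ≈-trans (⊛-congₘ {f = E} {f' = E} (k′ ℕ.+ i) (λ _ → ≈-refl) (λ j j≤ → W≈g j (ℕ.≤-trans j≤ n≤N)))
            (E⊛g≈0 (k′ ℕ.+ i) (ℕ.m≤m+n k′ i) n≤N))
      θDW : Vanishes k (θ D ⊛ W)
      θDW n k≤n = begin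
        (θ D ⊛ W) n                     ≡⟨ lem (+ k * (D ⊛ W) n) ((θ D ⊛ W) n) ⟩
        + k * (D ⊛ W) n ℤ.- (+ k * (D ⊛ W) n + - + 1 * (θ D ⊛ W) n)
          ≡⟨ cong (λ z → + k * (D ⊛ W) n ℤ.- z) (E⊛≐ W n) ⟨
        + k * (D ⊛ W) n ℤ.- (E ⊛ W) n
          ≈⟨ +-cong (*-zeroʳ (+ k) (DW n k≤n)) (-‿cong (EW n (ℕ.<⇒≤ k≤n))) ⟩
        + 0 ∎
        where
        lem : ∀ a b → b ≡ a ℤ.- (a + - + 1 * b)
        lem = solve-∀
      v≈0 : IsZero v
      v≈0 i = begin
        v i              ≡⟨ g-window i ⟨
        g (N ∸ toℕ i)    ≈⟨ W≈g (N ∸ toℕ i) (ℕ.m∸n≤m N (toℕ i)) ⟨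
        W (N ∸ toℕ i)    ≈⟨ coprime-annihilators ΔF≈0 c≉0 DW θDW (N ∸ toℕ i) z≤n ⟩
        + 0              ∎

  -- Existence and minimality of the period

  private instance
    p≢0 : NonZero p
    p≢0 = prime⇒nonZero p-prime

  residue : ℤ → Fin p
  residue a = fromℕ< (ℤ.n%ℕd<d a p)

  residue-injective : ∀ {a b} → residue a ≡ residue b → a ≈ b
  residue-injective {a} {b} e = ≈-trans (≈residue a) (≈-trans (≡⇒≈ (cong (+_ ∘ toℕ) e)) (≈-sym (≈residue b)))
    where
    ≈residue : ∀ a → a ≈ + toℕ (residue a)
    ≈residue a = congruent (a ℤ./ℕ p)
      (trans (ℤ.a≡a%ℕn+[a/ℕn]*n a p) (cong (λ r → + r + (a ℤ./ℕ p) * + p) (sym (Fin.toℕ-fromℕ< (ℤ.n%ℕd<d a p)))))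

  -- The k consecutive residues that determine the recurrence, coded as an element of a finite set
  -- for the pigeonhole principle.
  state : (k : ℕ) → Series → ℕ → Fin (p ℕ.^ k)
  state k f i = funToFin (λ (l : Fin k) → residue (f (i ℕ.+ toℕ l)))

  state-injective : ∀ k f {i j} → state k f i ≡ state k f j → ∀ (l : Fin k) → f (i ℕ.+ toℕ l) ≈ f (j ℕ.+ toℕ l)
  state-injective k f {i} {j} e l = residue-injective (begin
    residue (f (i ℕ.+ toℕ l))                       ≡⟨ Fin.finToFun-funToFin (λ (l : Fin k) → residue (f (i ℕ.+ toℕ l))) l ⟨
    finToFun (state k f i) l                        ≡⟨ cong (λ s → finToFun s l) e ⟩
    finToFun (state k f j) l                        ≡⟨ Fin.finToFun-funToFin (λ (l : Fin k) → residue (f (j ℕ.+ toℕ l))) l ⟩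
    residue (f (j ℕ.+ toℕ l))                       ∎)
    where open ≡-Reasoning

  module Period (k′ : ℕ) (t : Fin (suc k′) → ℤ) (t-last≉0 : ¬ tLast (suc k′) t ≈ + 0) where

    open Recurrence k′ t
    open Discriminant k′ t t-last≉0
    open Inverse k′ D (≡⇒≈ D-zero) D-vanishes D-top≉0 Fₖ D⊛F≐1

    Period : ℕ → Set
    Period T = 1 ≤ T × Vanishes 0 (Δ T Fₖ)

    -- The difference obeys the recurrence of F, so k values decide the infinitely many conditions;
    -- this makes periods decidable.
    vanishing-window : ∀ T → (∀ (i : Fin k) → Δ T Fₖ (toℕ i) ≈ + 0) → Vanishes 0 (Δ T Fₖ)
    vanishing-window T z = forward 0 (Δ T Fₖ) (Δ-recurrence T D⊛F-vanishes)
      (λ i i<k → subst (λ j → Δ T Fₖ j ≈ + 0) (Fin.toℕ-fromℕ< i<k) (z (fromℕ< i<k)))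

    Period? : Decidable Period
    Period? T = (1 ≤? T) ×-dec map′ (vanishing-window T) (λ v i → v (toℕ i) z≤n)
                                   (Fin.all? (λ i → Δ T Fₖ (toℕ i) ≈? + 0))

    -- Two of p^k + 1 states agree. Their difference vanishes onwards by the recurrence, and down to
    -- index 0 because t_k is a unit; hence there is no preperiod.
    period-exists : ∃ Period
    period-exists with Fin.pigeonhole (ℕ.n<1+n (p ℕ.^ k)) (state k Fₖ ∘ toℕ)
    ... | i , j , i<j , e = T , ℕ.m<n⇒0<n∸m i<j ,
          backward (Δ-recurrence T D⊛F-vanishes) (toℕ i)
            (forward (toℕ i) (Δ T Fₖ) (λ n i+k≤n → Δ-recurrence T D⊛F-vanishes n (ℕ.m+n≤o⇒n≤o (toℕ i) i+k≤n)) repeat)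
      where
      T = toℕ j ∸ toℕ i
      i+l+T≡j+l : ∀ l → toℕ i ℕ.+ l ℕ.+ T ≡ toℕ j ℕ.+ l
      i+l+T≡j+l l = begin
        toℕ i ℕ.+ l ℕ.+ T     ≡⟨ cong (ℕ._+ T) (ℕ.+-comm (toℕ i) l) ⟩
        l ℕ.+ toℕ i ℕ.+ T     ≡⟨ ℕ.+-assoc l (toℕ i) T ⟩
        l ℕ.+ (toℕ i ℕ.+ T)   ≡⟨ cong (l ℕ.+_) (ℕ.m+[n∸m]≡n (ℕ.<⇒≤ i<j)) ⟩
        l ℕ.+ toℕ j           ≡⟨ ℕ.+-comm l (toℕ j) ⟩
        toℕ j ℕ.+ l           ∎
        where open ≡-Reasoning
      repeat : ∀ l → l < k → Δ T Fₖ (toℕ i ℕ.+ l) ≈ + 0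
      repeat l l<k = a≈b⇒a-b≈0 (subst₂ (λ x y → Fₖ x ≈ Fₖ y)
        (trans (cong (toℕ j ℕ.+_) (Fin.toℕ-fromℕ< l<k)) (sym (i+l+T≡j+l l)))
        (cong (toℕ i ℕ.+_) (Fin.toℕ-fromℕ< l<k))
        (≈-sym (state-injective k Fₖ {toℕ i} {toℕ j} e (fromℕ< l<k))))

    -- The sign squares to 1, so it can be cancelled by multiplying with it again.
    disc≈0⇔Res≈0 : (+ p) ∣ℤ discC k t ⇔ Res ≈ + 0
    disc≈0⇔Res≈0 = mk⇔
      (λ p∣disc → ≈-trans (≡⇒≈ (lem (signPow e) (signPow-square e))) (*-zeroʳ (signPow e) (∣⇒≈0 {discC k t} p∣disc)))
      (λ Res≈0 → ≈0⇒∣ (*-zeroʳ (signPow e) Res≈0))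
      where
      e = (k ℕ.* k′) ℕ./ 2
      lem : ∀ s → s * s ≡ + 1 → Res ≡ s * (s * Res)
      lem s eq = trans (sym (ℤ.*-identityˡ Res)) (trans (cong (_* Res) (sym eq)) (ℤ.*-assoc s s Res))

    module _ {c} (period : Period c) (minimal : ∀ T → Period T → c ≤ T) where

      p∣c⇒Res≈0 : p ∣ c → Res ≈ + 0
      p∣c⇒Res≈0 (divides zero refl) = contradiction (proj₁ period) λ ()
      p∣c⇒Res≈0 (divides q@(suc _) refl) with Res ≈? + 0
      ... | yes Res≈0 = Res≈0
      ... | no Res≉0  = contradiction (minimal q (s≤s z≤n , period/p q (proj₂ period) Res≉0))
              (ℕ.<⇒≱ (ℕ.m<m*n q p (ℕ.nonTrivial⇒n>1 p ⦃ prime⇒nonTrivial p-prime ⦄)))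

      Res≈0⇒p∣c : Res ≈ + 0 → p ∣ c
      Res≈0⇒p∣c Res≈0 with p ∣? c
      ... | yes p∣c = p∣c
      ... | no p∤c  = contradiction Res≈0 (Res≉0 (proj₂ period) (p∤c ∘ ≈0⇒∣))

theorem6p7 : (k : ℕ) → 1 ≤ k → (t : Fin k → ℤ)
    → IrreducibleOverℚ k (λ i → toℚ (coeffC k t i))
    → (p : ℕ) → Prime p → ¬ ((+ p) ∣ℤ tLast k t)
    → Σ ℕ λ c → IsLeastPeriodMod p (F k t) c × ((p ∣ c) ⇔ ((+ p) ∣ℤ discC k t))
theorem6p7 (suc k′) _ t _ p p-prime p∤t-last =
  let T , period-T = period-exists
      c , period , minimal = least Period? T period-T
  in c
   , ( (proj₁ period , λ n → ≈⇒mod (a-b≈0⇒a≈b {F k t (n ℕ.+ c)} (proj₂ period n z≤n)))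
     , λ T (1≤T , T-period) → minimal T (1≤T , λ n _ → a≈b⇒a-b≈0 (mod⇒≈ {F k t (n ℕ.+ T)} (T-period n))))
   , mk⇔ (Equivalence.from disc≈0⇔Res≈0 ∘ p∣c⇒Res≈0 period minimal)
         (Res≈0⇒p∣c period minimal ∘ Equivalence.to disc≈0⇔Res≈0)
  where
  k = suc k′
  open Modulo p p-prime
  open Period k′ t (p∤t-last ∘ ≈0⇒∣)
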